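{- Let $M\in\mathbb{Q}^{d\times d}$ and $x\in\mathbb{Q}^d$ have non-negative entries, and let $(M',x')$ be the phase-annotated system constructed from $(M,x)$ as described in the context, with rounded orbit $(x'^{(t)})_{t\in\mathbb{N}}$. Let $S$ be a top strongly connected component of the graph $G_{M'}$ (i.e. one with no incoming edge from a vertex outside $S$). Then the sequence $(x'^{(t)}_{S})_{t\in\mathbb{N}}$ of restrictions of the orbit to the coordinates in $S$ is effectively pseudo-periodic.
   Context: Floating-point numbers with precision $p$ (base 10) are $\pm m\cdot10^\alpha$, $\alpha\in\mathbb{Z}$, $m\in\{0\}\cup[0.1,1)$ a decimal with $p$ digits after the point. The rounding $[z]$ is the closest such number determined by the first $p+1$ significant digits of $z$, ties broken by a fixed deterministic rule; it satisfies $|z|/c\le|[z]|\le c|z|$ for a constant $c>0$, $[10^\alpha z]=10^\alpha[z]$, depends only on the first $p+1$ mantissa digits, and preserves sign. Rounding is componentwise; the rounded orbit of $(A,y)$ is $y^{(0)}=[y]$, $y^{(t)}=[Ay^{(t-1)}]$. For a matrix $A$ indexed by a set $Q$, $G_A$ is the directed graph on $Q$ with an edge from $q'$ to $q$ iff $A_{q,q'}\ne0$. Construction: let $Q=\{1,\dots,d\}$ index $M$ and let $P$ be the least common multiple of the lengths of all simple cycles of $G_M$. Set $Q'=Q\times\{0,\dots,P-1\}$ and define $M'$ indexed by $Q'$ by $M'_{(q,i+1 \bmod P),(q',i)}=M_{q,q'}$ for all $i$, all other entries $0$; define $x'_{(q,0)}=x_q$ and $x'_{(q,i)}=0$ for $i\ne0$.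 A sequence of vectors indexed by a finite set $S$ with floating-point entries is pseudo-periodic if there are $N\in\mathbb{N}$, $T\ge1$ and $\alpha_s\in\mathbb{Z}$ ($s\in S$) with $y^{(t+T)}_s=10^{\alpha_s}y^{(t)}_s$ for all $t\ge N$, $s\in S$; it is effectively pseudo-periodic if such constants can be computed. -}

module Defs where

open import Data.Bool using (Bool; true; false; if_then_else_; _∧_; _∨_)
open import Data.Nat as ℕ using (ℕ; zero; suc; _^_; _<ᵇ_; _≡ᵇ_; NonZero)
open import Data.Nat.Divisibility using (_∣_)
open import Data.Nat.DivMod using (_/_; _%_)
open import Data.Nat.Properties using (m^n≢0)
open import Data.Integer as ℤ using (ℤ; +_; -[1+_])
open import Data.Rational as ℚ using (ℚ; 0ℚ; _+_; _*_; -_; floor; _<_; _≤_)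
open import Data.Fin using (Fin; toℕ)
open import Data.Product using (Σ; ∃; _×_; _,_)
open import Data.Sum using (_⊎_)
open import Function.Definitions using (Injective)
open import Relation.Binary.PropositionalEquality using (_≡_; _≢_)
open import Relation.Binary.Construct.Closure.ReflexiveTransitive using (Star)

pow10 : ℤ → ℚ
pow10 (+ n)    = (+ (10 ^ n)) ℚ./ 1
pow10 -[1+ n ] = ℚ._/_ (+ 1) (10 ^ suc n) {{m^n≢0 10 (suc n)}}

ℕ→ℚ : ℕ → ℚ
ℕ→ℚ n = (+ n) ℚ./ 1

-- For z > 0 there is a unique exponent e ∈ ℤ with
--   10^p ≤ z·10^(-e) < 10^(p+1);
-- the first p+1 significant digits of z form the integer
--   D = ⌊ z·10^(-e) ⌋  ∈ [10^p, 10^(p+1)).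
-- The rounded value is K·10^(e+1) where K = ⌊D/10⌋ or ⌊D/10⌋+1 according
-- to the last digit D mod 10 (< 5 : down, > 5 : up, = 5 : tie, broken by
-- the fixed deterministic rule `tie`, which may depend on the sign and on
-- the first p+1 digits).  Negative numbers are handled by symmetry with
-- the sign passed to the tie rule.

TieRule : Set
TieRule = Bool → ℕ → Bool   -- (is negative?) → (first p+1 digits D) → round up?

roundMant : TieRule → Bool → ℕ → ℕ
roundMant tie neg D =
  if (D % 10) <ᵇ 5 then D / 10
  else if 5 <ᵇ (D % 10) then suc (D / 10)
  else (if tie neg D then suc (D / 10) else D / 10)

Normalised : ℕ → ℤ → ℚ → Set
Normalised p e z = (ℕ→ℚ (10 ^ p) ≤ z * pow10 (ℤ.- e)) × (z * pow10 (ℤ.- e) < ℕ→ℚ (10 ^ suc p))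

digits : ℤ → ℚ → ℕ
digits e z = ℤ.∣ floor (z * pow10 (ℤ.- e)) ∣

-- Rounds p tie z r  :  r = [z]  (rounding is a function: e is unique)
Rounds : ℕ → TieRule → ℚ → ℚ → Set
Rounds p tie z r =
    (z ≡ 0ℚ × r ≡ 0ℚ)
  ⊎ (0ℚ < z × Σ ℤ λ e → Normalised p e z ×
       r ≡ ℕ→ℚ (roundMant tie false (digits e z)) * pow10 (e ℤ.+ ℤ.1ℤ))
  ⊎ (z < 0ℚ × Σ ℤ λ e → Normalised p e (- z) ×
       r ≡ - (ℕ→ℚ (roundMant tie true (digits e (- z))) * pow10 (e ℤ.+ ℤ.1ℤ)))

sumFin : ∀ {n} → (Fin n → ℚ) → ℚ
sumFin {zero}  f = 0ℚ
sumFin {suc n} f = f Fin.zero + sumFin (λ i → f (Fin.suc i))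

isNext : (k : ℕ) → Fin k → Fin k → Bool
isNext k i j = (toℕ j ≡ᵇ suc (toℕ i)) ∨ ((toℕ j ≡ᵇ 0) ∧ (suc (toℕ i) ≡ᵇ k))

Matrix : Set → Set
Matrix V = V → V → ℚ

Edge : ∀ {V : Set} → Matrix V → V → V → Set
Edge A q' q = A q q' ≢ 0ℚ

SimpleCycle : ∀ {d} → Matrix (Fin d) → ℕ → Set
SimpleCycle {d} M k =
  (1 ℕ.≤ k) × Σ (Fin k → Fin d) λ c →
    Injective _≡_ _≡_ c × (∀ i j → isNext k i j ≡ true → Edge M (c i) (c j))

IsCycleLCM : ∀ {d} → Matrix (Fin d) → ℕ → Set
IsCycleLCM M P =
    (∀ k → SimpleCycle M k → k ∣ P)
  × (∀ m → (∀ k → SimpleCycle M k → k ∣ m) → P ∣ m)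

Q' : ℕ → ℕ → Set
Q' d P = Fin d × Fin P

M′ : ∀ {d} (P : ℕ) → Matrix (Fin d) → Matrix (Q' d P)
M′ P M (q , j) (q' , i) = if isNext P i j then M q q' else 0ℚ

x′ : ∀ {d} (P : ℕ) → (Fin d → ℚ) → Q' d P → ℚ
x′ P x (q , i) = if toℕ i ≡ᵇ 0 then x q else 0ℚ

mulVec : ∀ {d P} → Matrix (Q' d P) → (Q' d P → ℚ) → Q' d P → ℚ
mulVec A y s = sumFin (λ q' → sumFin (λ i → A s (q' , i) * y (q' , i)))

IsRoundedOrbit : ∀ {d P} → ℕ → TieRule → Matrix (Q' d P) → (Q' d P → ℚ)
               → (ℕ → Q' d P → ℚ) → Set
IsRoundedOrbit p tie A x y =
    (∀ s → Rounds p tie (x s) (y 0 s))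
  × (∀ t s → Rounds p tie (mulVec A (y t) s) (y (suc t) s))

Reach : ∀ {V : Set} → Matrix V → V → V → Set
Reach A = Star (Edge A)

IsSCC : ∀ {V : Set} → Matrix V → (V → Bool) → Set
IsSCC {V} A S =
    (Σ V λ s → S s ≡ true)
  × (∀ u v → S u ≡ true → S v ≡ true → Reach A u v)
  × (∀ u v → S u ≡ true → Reach A u v → Reach A v u → S v ≡ true)

IsTop : ∀ {V : Set} → Matrix V → (V → Bool) → Set
IsTop A S = ∀ u v → Edge A u v → S v ≡ true → S u ≡ true

-- Pseudo-periodicity of the restriction to S (constants given explicitly,
-- hence computable in a constructive proof)

PseudoPeriodicOn : ∀ {V : Set} → (V → Bool) → (ℕ → V → ℚ) → Set
PseudoPeriodicOn {V} S y =
  Σ ℕ λ N → Σ ℕ λ T → (1 ℕ.≤ T) × Σ (V → ℤ) λ α →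
    ∀ t → N ℕ.≤ t → ∀ s → S s ≡ true → y (t ℕ.+ T) s ≡ pow10 (α s) * y t s

-- Track the decimal exponents of the rounded values.  Since M' is nonnegative, along an edge of G_{M'} a nonzero
-- value stays nonzero and its exponent drops by at most a constant κ; since S is top, S is fed only by S, so the
-- largest exponent on S grows by at most a constant per step.  The lcm P makes a simple cycle of G_M lift to a
-- closed walk of length exactly P inside S, so any two vertices of S in the same phase are joined by walks of one
-- common length L, and therefore after time L every live exponent on S lies within a fixed distance ρ of the
-- largest one.  A rounded value is a p-digit mantissa times a power of ten, so after time L the state of S, up to a
-- common power of ten, ranges over a finite set.  By pigeonhole two times t < t' carry the same state up to a
-- factor 10^a, and since rounding commutes with multiplication by 10^a, the orbit on S repeats from t on with
-- period t' - t and factor 10^a.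

module Submission where

open import Defs
open import Data.Bool using (Bool; true; false; T; _∧_)
import Data.Bool.Properties as Boolₚ
open import Data.Nat as ℕ using (ℕ; zero; suc; _%_; NonZero)
import Data.Nat.Properties as ℕₚ
import Data.Nat.DivMod as ℕ
import Data.Nat.Solver as ℕ-Solver
open import Data.Nat.Divisibility using (_∣_; divides; quotient)
open import Data.Nat.Induction using (<-rec)
import Data.Nat.Coprimality as Coprime
open import Data.Integer as ℤ using (ℤ; +_; -[1+_])
import Data.Integer.Properties as ℤₚ
import Data.Integer.Solver as ℤ-Solver
open import Data.Rational as ℚ using (ℚ; 0ℚ; 1ℚ; _+_; _*_; _<_; _≤_; mkℚ)
import Data.Rational.Properties as ℚₚ
import Data.Rational.Solver as ℚ-Solver
import Data.Rational.Unnormalised as ℚᵘ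
import Data.Rational.Unnormalised.Properties as ℚᵘₚ
open import Data.Fin as Fin using (Fin; toℕ)
import Data.Fin.Properties as Finₚ
open import Data.Empty using (⊥; ⊥-elim)
open import Data.Product using (Σ; _×_; _,_; proj₁; proj₂)
open import Data.Sum using (_⊎_; inj₁; inj₂; [_,_]′)
open import Function using (_∘′_)
open import Function.Bundles using (Equivalence)
open import Relation.Nullary using (Dec; yes; no; ¬_; ¬?)
open import Relation.Nullary.Decidable using (_×-dec_; decidable-stable)
open import Relation.Binary.Definitions using (tri<; tri≈; tri>)
open import Relation.Binary.PropositionalEquality
open import Relation.Binary.Construct.Closure.ReflexiveTransitive using (Star; ε; _◅_)

open ≡-Reasoning

m+n+o+p≡m+o+p+n : ∀ m n o p → m ℕ.+ n ℕ.+ o ℕ.+ p ≡ m ℕ.+ o ℕ.+ p ℕ.+ n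
m+n+o+p≡m+o+p+n = solve 4 (λ m n o p → m :+ n :+ o :+ p := m :+ o :+ p :+ n) refl
  where open ℕ-Solver.+-*-Solver

[m%n+o]%n≡[m+o]%n : ∀ m o n .{{_ : ℕ.NonZero n}} → (m % n ℕ.+ o) % n ≡ (m ℕ.+ o) % n
[m%n+o]%n≡[m+o]%n m o n = begin
  (m % n ℕ.+ o) % n            ≡⟨ ℕ.%-distribˡ-+ (m % n) o n ⟩
  (m % n % n ℕ.+ o % n) % n    ≡⟨ cong (λ a → (a ℕ.+ o % n) % n) (ℕ.m%n%n≡m%n m n) ⟩
  (m % n ℕ.+ o % n) % n        ≡⟨ ℕ.%-distribˡ-+ m o n ⟨
  (m ℕ.+ o) % n                ∎

%-fixed⇒∣ : ∀ a ℓ P .{{_ : ℕ.NonZero P}} → (a ℕ.+ ℓ) % P ≡ a → P ∣ ℓ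
%-fixed⇒∣ a ℓ P fixed = divides ((a ℕ.+ ℓ) ℕ./ P)
  (ℕₚ.+-cancelˡ-≡ a ℓ _ (trans (ℕ.m≡m%n+[m/n]*n (a ℕ.+ ℓ) P) (cong (ℕ._+ (a ℕ.+ ℓ) ℕ./ P ℕ.* P) fixed)))

digit-unique : ∀ {B a a' x x'} → a ℕ.< B → a' ℕ.< B → a ℕ.+ B ℕ.* x ≡ a' ℕ.+ B ℕ.* x' → a ≡ a' × x ≡ x'
digit-unique {suc B₀} {a} {a'} {x} {x'} a<B a'<B eq =
  a≡a' , ℕₚ.*-cancelˡ-≡ x x' B (ℕₚ.+-cancelˡ-≡ a _ _ (trans eq (cong (ℕ._+ B ℕ.* x') (sym a≡a'))))
  where
  B = suc B₀
  a+Bx%B≡a : ∀ {a} x → a ℕ.< B → (a ℕ.+ B ℕ.* x) % B ≡ a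
  a+Bx%B≡a {a} x a<B = trans (cong (λ y → (a ℕ.+ y) % B) (ℕₚ.*-comm B x))
                             (trans (ℕ.[m+kn]%n≡m%n a x B) (ℕ.m<n⇒m%n≡m a<B))
  a≡a' : a ≡ a'
  a≡a' = trans (sym (a+Bx%B≡a x a<B)) (trans (cong (_% B) eq) (a+Bx%B≡a x' a'<B))

-a+[a+b]≡b : ∀ a b → ℤ.- a ℤ.+ (a ℤ.+ b) ≡ b
-a+[a+b]≡b = solve 2 (λ a b → (:- a) :+ (a :+ b) := b) refl
  where open ℤ-Solver.+-*-Solver

+-cancelˡ-≤ : ∀ a {b c} → a ℤ.+ b ℤ.≤ a ℤ.+ c → b ℤ.≤ c
+-cancelˡ-≤ a {b} {c} h = subst₂ ℤ._≤_ (-a+[a+b]≡b a b) (-a+[a+b]≡b a c) (ℤₚ.+-monoʳ-≤ (ℤ.- a) h)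

+-cancelˡ-< : ∀ a {b c} → a ℤ.+ b ℤ.< a ℤ.+ c → b ℤ.< c
+-cancelˡ-< a {b} {c} h = subst₂ ℤ._<_ (-a+[a+b]≡b a b) (-a+[a+b]≡b a c) (ℤₚ.+-monoʳ-< (ℤ.- a) h)

j'≡[i'-i]+j : ∀ i j i' j' → i ℤ.- j ≡ i' ℤ.- j' → j' ≡ (i' ℤ.- i) ℤ.+ j
j'≡[i'-i]+j i j i' j' same-difference = begin
  j'                  ≡⟨ solve 2 (λ i' j' → j' := i' :- (i' :- j')) refl i' j' ⟩
  i' ℤ.- (i' ℤ.- j')  ≡⟨ cong (λ d → i' ℤ.- d) same-difference ⟨
  i' ℤ.- (i ℤ.- j)    ≡⟨ solve 3 (λ i' i j → i' :- (i :- j) := (i' :- i) :+ j) refl i' i j ⟩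
  (i' ℤ.- i) ℤ.+ j    ∎
  where open ℤ-Solver.+-*-Solver

<+1⇒≤ : ∀ {k e} → k ℤ.< e ℤ.+ ℤ.1ℤ → k ℤ.≤ e
<+1⇒≤ {k} {e} h = subst (k ℤ.≤_) (ℤₚ.pred-suc e) (ℤₚ.i<j⇒i≤pred[j] (subst (k ℤ.<_) (ℤₚ.+-comm e ℤ.1ℤ) h))

n<10^n : ∀ n → n ℕ.< 10 ℕ.^ n
n<10^n zero = ℕ.s≤s ℕ.z≤n
n<10^n (suc n) = ℕₚ.<-≤-trans (ℕ.s≤s (n<10^n n))
  (subst (suc (10 ℕ.^ n) ℕ.≤_) (ℕₚ.*-comm (10 ℕ.^ n) 10)
    (ℕₚ.m<m*n (10 ℕ.^ n) 10 {{ℕₚ.m^n≢0 10 n}} (ℕ.s≤s (ℕ.s≤s ℕ.z≤n))))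

maxFin : ∀ {n} → (Fin n → ℕ) → ℕ
maxFin {zero} f = 0
maxFin {suc n} f = f Fin.zero ℕ.⊔ maxFin (λ i → f (Fin.suc i))

≤-maxFin : ∀ {n} (f : Fin n → ℕ) i → f i ℕ.≤ maxFin f
≤-maxFin f Fin.zero = ℕₚ.m≤m⊔n _ _
≤-maxFin f (Fin.suc i) = ℕₚ.≤-trans (≤-maxFin (λ i → f (Fin.suc i)) i) (ℕₚ.m≤n⊔m _ _)

ℕ→ℚ≡mkℚ : ∀ n → ℕ→ℚ n ≡ mkℚ (+ n) 0 (Coprime.sym (Coprime.1-coprimeTo n))
ℕ→ℚ≡mkℚ n = ℚₚ.normalize-coprime (Coprime.sym (Coprime.1-coprimeTo n))

toℚᵘ-/ : ∀ i k → ℚ.toℚᵘ (i ℚ./ suc k) ℚᵘ.≃ ℚᵘ.mkℚᵘ i k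
toℚᵘ-/ i k = ℚₚ.toℚᵘ-fromℚᵘ (ℚᵘ.mkℚᵘ i k)

ℕ→ℚ-+ : ∀ m n → ℕ→ℚ (m ℕ.+ n) ≡ ℕ→ℚ m + ℕ→ℚ n
ℕ→ℚ-+ m n = ℚₚ.toℚᵘ-injective (ℚᵘₚ.≃-trans (toℚᵘ-/ (+ (m ℕ.+ n)) 0)
  (ℚᵘₚ.≃-trans (ℚᵘ.*≡* (cong (ℤ._* + 1) eq))
    (ℚᵘₚ.≃-sym (ℚᵘₚ.≃-trans (ℚₚ.toℚᵘ-homo-+ (ℕ→ℚ m) (ℕ→ℚ n))
     (ℚᵘₚ.+-cong (toℚᵘ-/ (+ m) 0) (toℚᵘ-/ (+ n) 0))))))
  where
  eq : + (m ℕ.+ n) ≡ + m ℤ.* + 1 ℤ.+ + n ℤ.* + 1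
  eq = trans (ℤₚ.pos-+ m n) (sym (cong₂ ℤ._+_ (ℤₚ.*-identityʳ (+ m)) (ℤₚ.*-identityʳ (+ n))))

ℕ→ℚ-* : ∀ m n → ℕ→ℚ (m ℕ.* n) ≡ ℕ→ℚ m * ℕ→ℚ n
ℕ→ℚ-* m n = ℚₚ.toℚᵘ-injective (ℚᵘₚ.≃-trans (toℚᵘ-/ (+ (m ℕ.* n)) 0)
  (ℚᵘₚ.≃-trans (ℚᵘ.*≡* (cong (ℤ._* + 1) (ℤₚ.pos-* m n)))
    (ℚᵘₚ.≃-sym (ℚᵘₚ.≃-trans (ℚₚ.toℚᵘ-homo-* (ℕ→ℚ m) (ℕ→ℚ n))
     (ℚᵘₚ.*-cong (toℚᵘ-/ (+ m) 0) (toℚᵘ-/ (+ n) 0))))))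

ℕ→ℚ-mono-≤ : ∀ {m n} → m ℕ.≤ n → ℕ→ℚ m ≤ ℕ→ℚ n
ℕ→ℚ-mono-≤ {m} {n} m≤n rewrite ℕ→ℚ≡mkℚ m | ℕ→ℚ≡mkℚ n =
  ℚ.*≤* (subst₂ ℤ._≤_ (sym (ℤₚ.*-identityʳ (+ m))) (sym (ℤₚ.*-identityʳ (+ n))) (ℤ.+≤+ m≤n))

ℕ→ℚ-mono-< : ∀ {m n} → m ℕ.< n → ℕ→ℚ m < ℕ→ℚ n
ℕ→ℚ-mono-< {m} {n} m<n rewrite ℕ→ℚ≡mkℚ m | ℕ→ℚ≡mkℚ n =
  ℚ.*<* (subst₂ ℤ._<_ (sym (ℤₚ.*-identityʳ (+ m))) (sym (ℤₚ.*-identityʳ (+ n))) (ℤ.+<+ m<n))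

ℕ→ℚ-nonNeg : ∀ n → 0ℚ ≤ ℕ→ℚ n
ℕ→ℚ-nonNeg n = ℕ→ℚ-mono-≤ {0} {n} ℕ.z≤n

<⇒≱ : ∀ {p q : ℚ} → p < q → q ≤ p → ⊥
<⇒≱ p<q q≤p = ℚₚ.<-irrefl refl (ℚₚ.<-≤-trans p<q q≤p)

*-mono-≤ : ∀ {a b x y} → 0ℚ ≤ a → 0ℚ ≤ x → a ≤ b → x ≤ y → a * x ≤ b * y
*-mono-≤ {a} {b} {x} {y} a≥0 x≥0 a≤b x≤y =
  ℚₚ.≤-trans (ℚₚ.*-monoˡ-≤-nonNeg a {{ℚ.nonNegative a≥0}} x≤y)
             (ℚₚ.*-monoʳ-≤-nonNeg y {{ℚ.nonNegative (ℚₚ.≤-trans x≥0 x≤y)}} a≤b)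

*-nonNeg : ∀ {a b} → 0ℚ ≤ a → 0ℚ ≤ b → 0ℚ ≤ a * b
*-nonNeg {a} {b} a≥0 b≥0 =
  ℚₚ.nonNegative⁻¹ (a * b) {{ℚₚ.nonNeg*nonNeg⇒nonNeg a {{ℚ.nonNegative a≥0}} b {{ℚ.nonNegative b≥0}}}}

*-pos : ∀ {a b} → 0ℚ < a → 0ℚ < b → 0ℚ < a * b
*-pos {a} {b} a>0 b>0 = ℚₚ.positive⁻¹ (a * b) {{ℚₚ.pos*pos⇒pos a {{ℚ.positive a>0}} b {{ℚ.positive b>0}}}}

≢0⇒>0 : ∀ {a} → 0ℚ ≤ a → a ≢ 0ℚ → 0ℚ < a
≢0⇒>0 {a} a≥0 a≢0 with ℚₚ.<-cmp 0ℚ a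
... | tri< a>0 _ _ = a>0
... | tri≈ _ 0≡a _ = ⊥-elim (a≢0 (sym 0≡a))
... | tri> _ _ a<0 = ⊥-elim (<⇒≱ a<0 a≥0)

*≢0⇒ : ∀ {a b} → a * b ≢ 0ℚ → a ≢ 0ℚ × b ≢ 0ℚ
*≢0⇒ {a} {b} ab≢0 = (λ a≡0 → ab≢0 (trans (cong (_* b) a≡0) (ℚₚ.*-zeroˡ b))) ,
                    (λ b≡0 → ab≢0 (trans (cong (a *_) b≡0) (ℚₚ.*-zeroʳ a)))

ten : ℚ
ten = ℕ→ℚ 10

1<ten : 1ℚ < ten
1<ten = ℕ→ℚ-mono-< {1} {10} (ℕ.s≤s (ℕ.s≤s ℕ.z≤n))

pow10-+suc : ∀ n → pow10 (+ suc n) ≡ ten * pow10 (+ n)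
pow10-+suc n = ℕ→ℚ-* 10 (10 ℕ.^ n)

1/m*m≡1 : ∀ m .{{_ : ℕ.NonZero m}} → ((+ 1) ℚ./ m) * ((+ m) ℚ./ 1) ≡ 1ℚ
1/m*m≡1 (suc k) = ℚₚ.toℚᵘ-injective (ℚᵘₚ.≃-trans (ℚₚ.toℚᵘ-homo-* ((+ 1) ℚ./ suc k) ((+ suc k) ℚ./ 1))
  (ℚᵘₚ.≃-trans (ℚᵘₚ.*-cong (toℚᵘ-/ (+ 1) k) (toℚᵘ-/ (+ suc k) 0)) (ℚᵘₚ.*-inverseˡ (ℚᵘ.mkℚᵘ (+ suc k) 0))))

pow10-inverse : ∀ n → pow10 -[1+ n ] * pow10 (+ suc n) ≡ 1ℚ
pow10-inverse n = 1/m*m≡1 (10 ℕ.^ suc n) {{ℕₚ.m^n≢0 10 (suc n)}}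

pow10-suc : ∀ a → pow10 (a ℤ.+ ℤ.1ℤ) ≡ pow10 a * ten
pow10-suc (+ n) = begin
  pow10 (+ (n ℕ.+ 1)) ≡⟨ cong (λ k → pow10 (+ k)) (ℕₚ.+-comm n 1) ⟩
  pow10 (+ suc n)     ≡⟨ pow10-+suc n ⟩
  ten * pow10 (+ n)   ≡⟨ ℚₚ.*-comm ten (pow10 (+ n)) ⟩
  pow10 (+ n) * ten   ∎
pow10-suc -[1+ zero ] = sym (pow10-inverse 0)
pow10-suc -[1+ suc n ] = begin
  v                               ≡⟨ sym (ℚₚ.*-identityˡ v) ⟩
  1ℚ * v                          ≡⟨ cong (_* v) (sym (pow10-inverse (suc n))) ⟩
  (u * pow10 (+ suc (suc n))) * v ≡⟨ cong (λ w → (u * w) * v) (pow10-+suc (suc n)) ⟩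
  (u * (ten * pow10 (+ suc n))) * v
    ≡⟨ solve 4 (λ u t w v → (u :* (t :* w)) :* v := (u :* t) :* (v :* w)) refl u ten (pow10 (+ suc n)) v ⟩
  (u * ten) * (v * pow10 (+ suc n)) ≡⟨ cong ((u * ten) *_) (pow10-inverse n) ⟩
  (u * ten) * 1ℚ                    ≡⟨ ℚₚ.*-identityʳ _ ⟩
  u * ten                           ∎
  where
  open ℚ-Solver.+-*-Solver
  u = pow10 -[1+ suc n ]
  v = pow10 -[1+ n ]

a+[n+1]≡[a+n]+1 : ∀ a n → a ℤ.+ + suc n ≡ (a ℤ.+ + n) ℤ.+ ℤ.1ℤ
a+[n+1]≡[a+n]+1 a n = trans (cong (λ k → a ℤ.+ + k) (ℕₚ.+-comm 1 n)) (sym (ℤₚ.+-assoc a (+ n) ℤ.1ℤ))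

pow10-+-+ : ∀ a n → pow10 (a ℤ.+ + n) ≡ pow10 a * pow10 (+ n)
pow10-+-+ a zero = trans (cong pow10 (ℤₚ.+-identityʳ a)) (sym (ℚₚ.*-identityʳ (pow10 a)))
pow10-+-+ a (suc n) = begin
  pow10 (a ℤ.+ + suc n)           ≡⟨ cong pow10 (a+[n+1]≡[a+n]+1 a n) ⟩
  pow10 ((a ℤ.+ + n) ℤ.+ ℤ.1ℤ)    ≡⟨ pow10-suc (a ℤ.+ + n) ⟩
  pow10 (a ℤ.+ + n) * ten         ≡⟨ cong (_* ten) (pow10-+-+ a n) ⟩
  (pow10 a * pow10 (+ n)) * ten   ≡⟨ ℚₚ.*-assoc (pow10 a) (pow10 (+ n)) ten ⟩
  pow10 a * (pow10 (+ n) * ten)   ≡⟨ cong (pow10 a *_) (sym (pow10-suc (+ n))) ⟩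
  pow10 a * pow10 (+ n ℤ.+ ℤ.1ℤ)  ≡⟨ cong (λ k → pow10 a * pow10 (+ k)) (ℕₚ.+-comm n 1) ⟩
  pow10 a * pow10 (+ suc n)       ∎

pow10-+ : ∀ a b → pow10 (a ℤ.+ b) ≡ pow10 a * pow10 b
pow10-+ a (+ n) = pow10-+-+ a n
pow10-+ a -[1+ n ] = begin
  c                                       ≡⟨ sym (ℚₚ.*-identityʳ c) ⟩
  c * 1ℚ                                  ≡⟨ cong (c *_) (sym (trans (ℚₚ.*-comm (pow10 (+ suc n)) v) (pow10-inverse n))) ⟩
  c * (pow10 (+ suc n) * v)               ≡⟨ sym (ℚₚ.*-assoc c (pow10 (+ suc n)) v) ⟩
  (c * pow10 (+ suc n)) * v               ≡⟨ cong (_* v) (sym (pow10-+-+ (a ℤ.+ -[1+ n ]) (suc n))) ⟩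
  pow10 ((a ℤ.+ -[1+ n ]) ℤ.+ + suc n) * v ≡⟨ cong (λ k → pow10 k * v) a-[1+n]+[1+n]≡a ⟩
  pow10 a * v                             ∎
  where
  c v : ℚ
  c = pow10 (a ℤ.+ -[1+ n ])
  v = pow10 -[1+ n ]
  a-[1+n]+[1+n]≡a : (a ℤ.+ -[1+ n ]) ℤ.+ + suc n ≡ a
  a-[1+n]+[1+n]≡a = trans (ℤₚ.+-assoc a -[1+ n ] (+ suc n))
    (trans (cong (λ k → a ℤ.+ k) (ℤₚ.+-inverseˡ (+ suc n))) (ℤₚ.+-identityʳ a))

pow10-pos : ∀ a → 0ℚ < pow10 a
pow10-pos (+ n) = ℚₚ.positive⁻¹ _ {{ℚₚ.normalize-pos (10 ℕ.^ n) 1 {{_}} {{ℕₚ.m^n≢0 10 n}}}}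
pow10-pos -[1+ n ] = ℚₚ.positive⁻¹ _ {{ℚₚ.normalize-pos 1 (10 ℕ.^ suc n) {{ℕₚ.m^n≢0 10 (suc n)}}}}

pow10-nonNeg : ∀ a → 0ℚ ≤ pow10 a
pow10-nonNeg a = ℚₚ.<⇒≤ (pow10-pos a)

pow10-<-suc : ∀ a → pow10 a < pow10 (a ℤ.+ ℤ.1ℤ)
pow10-<-suc a = subst₂ _<_ (ℚₚ.*-identityʳ (pow10 a)) (sym (pow10-suc a))
  (ℚₚ.*-monoʳ-<-pos (pow10 a) {{ℚ.positive (pow10-pos a)}} 1<ten)

pow10-≤-+ : ∀ a n → pow10 a ≤ pow10 (a ℤ.+ + n)
pow10-≤-+ a zero = ℚₚ.≤-reflexive (cong pow10 (sym (ℤₚ.+-identityʳ a)))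
pow10-≤-+ a (suc n) = ℚₚ.≤-trans (pow10-≤-+ a n)
  (ℚₚ.≤-trans (ℚₚ.<⇒≤ (pow10-<-suc (a ℤ.+ + n))) (ℚₚ.≤-reflexive (cong pow10 (sym (a+[n+1]≡[a+n]+1 a n)))))

pow10-mono-≤ : ∀ {a b} → a ℤ.≤ b → pow10 a ≤ pow10 b
pow10-mono-≤ {a} {b} a≤b = subst (λ c → pow10 a ≤ pow10 c) b≡a+∣b-a∣ (pow10-≤-+ a _)
  where
  b≡a+∣b-a∣ : a ℤ.+ + ℤ.∣ b ℤ.- a ∣ ≡ b
  b≡a+∣b-a∣ = trans (cong (λ c → a ℤ.+ c) (ℤₚ.0≤i⇒+∣i∣≡i (ℤₚ.i≤j⇒0≤j-i a≤b)))
                    (solve 2 (λ a b → a :+ (b :- a) := b) refl a b)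
    where open ℤ-Solver.+-*-Solver

pow10-mono-< : ∀ {a b} → a ℤ.< b → pow10 a < pow10 b
pow10-mono-< {a} {b} a<b = ℚₚ.<-≤-trans (pow10-<-suc a)
  (pow10-mono-≤ (subst (ℤ._≤ b) (ℤₚ.+-comm ℤ.1ℤ a) (ℤₚ.i<j⇒suc[i]≤j a<b)))

pow10-cancel-≤ : ∀ {a b} → pow10 a ≤ pow10 b → a ℤ.≤ b
pow10-cancel-≤ {a} {b} h with a ℤₚ.≤? b
... | yes a≤b = a≤b
... | no a≰b = ⊥-elim (<⇒≱ (pow10-mono-< (ℤₚ.≰⇒> a≰b)) h)

pow10-cancel-< : ∀ {a b} → pow10 a < pow10 b → a ℤ.< b
pow10-cancel-< {a} {b} h with a ℤₚ.<? b
... | yes a<b = a<b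
... | no a≮b = ⊥-elim (<⇒≱ h (pow10-mono-≤ (ℤₚ.≮⇒≥ a≮b)))

*-pow10-+ : ∀ K a b → K * pow10 (a ℤ.+ b) ≡ pow10 a * (K * pow10 b)
*-pow10-+ K a b = begin
  K * pow10 (a ℤ.+ b)        ≡⟨ cong (K *_) (pow10-+ a b) ⟩
  K * (pow10 a * pow10 b)    ≡⟨ solve 3 (λ K u v → K :* (u :* v) := u :* (K :* v)) refl K (pow10 a) (pow10 b) ⟩
  pow10 a * (K * pow10 b)    ∎
  where open ℚ-Solver.+-*-Solver

ℕ→ℚ≤pow10 : ∀ n → ℕ→ℚ n ≤ pow10 (+ n)
ℕ→ℚ≤pow10 n = ℕ→ℚ-mono-≤ (ℕₚ.<⇒≤ (n<10^n n))

≤-pow10-numerator : ∀ r → 0ℚ ≤ r → r ≤ pow10 (+ ℤ.∣ ℚ.↥ r ∣)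
≤-pow10-numerator (mkℚ (+ a) b c) _ = ℚₚ.≤-trans r≤a (ℕ→ℚ≤pow10 a)
  where
  r≤a : mkℚ (+ a) b c ≤ ℕ→ℚ a
  r≤a rewrite ℕ→ℚ≡mkℚ a = ℚ.*≤* (subst₂ ℤ._≤_ (sym (ℤₚ.*-identityʳ (+ a))) (ℤₚ.pos-* a (suc b))
                                    (ℤ.+≤+ (ℕₚ.m≤m*n a (suc b))))
≤-pow10-numerator (mkℚ -[1+ a ] b c) r≥0 with ℚₚ.drop-*≤* r≥0
... | ()

1/m≤ : ∀ m .{{_ : ℕ.NonZero m}} a b .(c : Coprime.Coprime (suc a) (suc b)) → suc b ℕ.≤ m →
       (+ 1) ℚ./ m ≤ mkℚ (+ suc a) b c
1/m≤ (suc k) a b c b<m = ℚₚ.toℚᵘ-cancel-≤ (ℚᵘₚ.≤-respˡ-≃ (ℚᵘₚ.≃-sym (toℚᵘ-/ (+ 1) k)) (ℚᵘ.*≤*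
  (subst₂ ℤ._≤_ (sym (ℤₚ.*-identityˡ (+ suc b))) (ℤₚ.pos-* (suc a) (suc k))
    (ℤ.+≤+ (ℕₚ.≤-trans b<m (ℕₚ.m≤n*m (suc k) (suc a)))))))

pow10-denominator≤ : ∀ r → 0ℚ ≤ r → r ≢ 0ℚ → pow10 (ℤ.- (+ ℚ.↧ₙ r)) ≤ r
pow10-denominator≤ (mkℚ (+ zero) b c) _ r≢0 = ⊥-elim (r≢0 (ℚₚ.↥p≡0⇒p≡0 (mkℚ (+ zero) b c) refl))
pow10-denominator≤ (mkℚ (+ suc a) b c) _ _ =
  1/m≤ (10 ℕ.^ suc b) {{ℕₚ.m^n≢0 10 (suc b)}} a b c (ℕₚ.<⇒≤ (n<10^n (suc b)))
pow10-denominator≤ (mkℚ -[1+ a ] b c) r≥0 _ with ℚₚ.drop-*≤* r≥0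
... | ()

Pow10Bounded : ∀ {d} → Matrix (Fin d) → ℕ → Set
Pow10Bounded M κ = (∀ q q' → M q q' ≤ pow10 (+ κ)) × (∀ q q' → M q q' ≢ 0ℚ → pow10 (ℤ.- (+ κ)) ≤ M q q')

entries-between-pow10 : ∀ {d} (M : Matrix (Fin d)) → (∀ q q' → 0ℚ ≤ M q q') → Σ ℕ (Pow10Bounded M)
entries-between-pow10 M M≥0 = κ , upper , lower
  where
  size : ℚ → ℕ
  size r = ℤ.∣ ℚ.↥ r ∣ ℕ.+ ℚ.↧ₙ r
  κ : ℕ
  κ = maxFin (λ q → maxFin (λ q' → size (M q q')))
  size≤κ : ∀ q q' → size (M q q') ℕ.≤ κ
  size≤κ q q' = ℕₚ.≤-trans (≤-maxFin _ q') (≤-maxFin (λ q → maxFin (λ q' → size (M q q'))) q)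
  upper : ∀ q q' → M q q' ≤ pow10 (+ κ)
  upper q q' = ℚₚ.≤-trans (≤-pow10-numerator (M q q') (M≥0 q q'))
    (pow10-mono-≤ (ℤ.+≤+ (ℕₚ.≤-trans (ℕₚ.m≤m+n ℤ.∣ ℚ.↥ (M q q') ∣ _) (size≤κ q q'))))
  lower : ∀ q q' → M q q' ≢ 0ℚ → pow10 (ℤ.- (+ κ)) ≤ M q q'
  lower q q' M≢0 = ℚₚ.≤-trans
    (pow10-mono-≤ (ℤₚ.neg-mono-≤ (ℤ.+≤+ (ℕₚ.≤-trans (ℕₚ.m≤n+m (ℚ.↧ₙ (M q q')) _) (size≤κ q q')))))
    (pow10-denominator≤ (M q q') (M≥0 q q') M≢0)

-- Floating-point rounding

floor-bounds : ∀ w n m → ℕ→ℚ n ≤ w → w < ℕ→ℚ m → n ℕ.≤ ℤ.∣ ℚ.floor w ∣ × ℤ.∣ ℚ.floor w ∣ ℕ.< m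
floor-bounds (mkℚ (+ a) b c) n m n≤w w<m = lower , upper
  where
  ∣floor∣≡a/b : ℤ.∣ ℚ.floor (mkℚ (+ a) b c) ∣ ≡ a ℕ./ suc b
  ∣floor∣≡a/b = cong ℤ.∣_∣ (ℤₚ.*-identityˡ (+ (a ℕ./ suc b)))
  nb≤a : n ℕ.* suc b ℕ.≤ a
  nb≤a = ℤₚ.drop‿+≤+ (subst₂ ℤ._≤_ (sym (ℤₚ.pos-* n (suc b))) (ℤₚ.*-identityʳ (+ a))
           (subst (λ x → ℚ.↥ x ℤ.* + suc b ℤ.≤ + a ℤ.* ℚ.↧ x) (ℕ→ℚ≡mkℚ n) (ℚₚ.drop-*≤* n≤w)))
  a<mb : a ℕ.< m ℕ.* suc b
  a<mb = ℤₚ.drop‿+<+ (subst₂ ℤ._<_ (ℤₚ.*-identityʳ (+ a)) (sym (ℤₚ.pos-* m (suc b)))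
           (subst (λ x → + a ℤ.* ℚ.↧ x ℤ.< ℚ.↥ x ℤ.* + suc b) (ℕ→ℚ≡mkℚ m) (ℚₚ.drop-*<* w<m)))
  lower = subst (n ℕ.≤_) (sym ∣floor∣≡a/b)
            (subst (ℕ._≤ a ℕ./ suc b) (ℕ.m*n/n≡m n (suc b)) (ℕ./-monoˡ-≤ (suc b) nb≤a))
  upper = subst (ℕ._< m) (sym ∣floor∣≡a/b) (ℕ.m<n*o⇒m/o<n a<mb)
floor-bounds (mkℚ -[1+ a ] b _) n m n≤w _ with
  subst₂ ℤ._≤_ (sym (ℤₚ.pos-* n (suc b))) (ℤₚ.*-identityʳ -[1+ a ])
    (subst (λ x → ℚ.↥ x ℤ.* + suc b ℤ.≤ -[1+ a ] ℤ.* ℚ.↧ x) (ℕ→ℚ≡mkℚ n) (ℚₚ.drop-*≤* n≤w))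
... | ()

roundMant-cases : ∀ tie neg D → roundMant tie neg D ≡ D ℕ./ 10 ⊎ roundMant tie neg D ≡ suc (D ℕ./ 10)
roundMant-cases tie neg D with (D ℕ.% 10) ℕ.<ᵇ 5
... | true = inj₁ refl
... | false with 5 ℕ.<ᵇ (D ℕ.% 10)
... | true = inj₂ refl
... | false with tie neg D
... | true = inj₂ refl
... | false = inj₁ refl

roundMant-bounds : ∀ p₀ tie neg D → 10 ℕ.^ suc p₀ ℕ.≤ D → D ℕ.< 10 ℕ.^ suc (suc p₀) →
                   10 ℕ.^ p₀ ℕ.≤ roundMant tie neg D × roundMant tie neg D ℕ.≤ 10 ℕ.^ suc p₀
roundMant-bounds p₀ tie neg D lower upper = bounds (roundMant-cases tie neg D)
  where
  lower/10 : 10 ℕ.^ p₀ ℕ.≤ D ℕ./ 10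
  lower/10 = subst (ℕ._≤ D ℕ./ 10) (ℕ.m*n/n≡m (10 ℕ.^ p₀) 10)
               (ℕ./-monoˡ-≤ 10 (subst (ℕ._≤ D) (ℕₚ.*-comm 10 (10 ℕ.^ p₀)) lower))
  upper/10 : D ℕ./ 10 ℕ.< 10 ℕ.^ suc p₀
  upper/10 = ℕ.m<n*o⇒m/o<n (subst (D ℕ.<_) (ℕₚ.*-comm 10 (10 ℕ.^ suc p₀)) upper)
  bounds : ∀ {K} → K ≡ D ℕ./ 10 ⊎ K ≡ suc (D ℕ./ 10) → 10 ℕ.^ p₀ ℕ.≤ K × K ℕ.≤ 10 ℕ.^ suc p₀
  bounds (inj₁ refl) = lower/10 , ℕₚ.<⇒≤ upper/10
  bounds (inj₂ refl) = ℕₚ.m≤n⇒m≤1+n lower/10 , upper/10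

module Rounding (p₀ : ℕ) (tie : TieRule) where

  open ℤ-Solver.+-*-Solver using (solve; _:+_; :-_; con; _:=_)

  p : ℕ
  p = suc p₀

  -- The positive numbers with normalising exponent e are those in [threshold e, threshold (e + 1)).
  threshold : ℤ → ℚ
  threshold e = pow10 (+ p ℤ.+ e)

  threshold-cancel-< : ∀ {k e} → threshold k < threshold e → k ℤ.< e
  threshold-cancel-< h = +-cancelˡ-< (+ p) (pow10-cancel-< h)

  threshold-cancel-≤ : ∀ {k e} → threshold k ≤ threshold e → k ℤ.≤ e
  threshold-cancel-≤ h = +-cancelˡ-≤ (+ p) (pow10-cancel-≤ h)

  pow10-*-threshold : ∀ a k → pow10 a * threshold k ≡ threshold (k ℤ.+ a)
  pow10-*-threshold a k = trans (sym (pow10-+ a (+ p ℤ.+ k)))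
    (cong pow10 (solve 3 (λ a p k → a :+ (p :+ k) := p :+ (k :+ a)) refl a (+ p) k))

  unscale : ∀ z e → (z * pow10 (ℤ.- e)) * pow10 e ≡ z
  unscale z e = begin
    (z * pow10 (ℤ.- e)) * pow10 e ≡⟨ ℚₚ.*-assoc z (pow10 (ℤ.- e)) (pow10 e) ⟩
    z * (pow10 (ℤ.- e) * pow10 e) ≡⟨ cong (z *_) (sym (pow10-+ (ℤ.- e) e)) ⟩
    z * pow10 (ℤ.- e ℤ.+ e)       ≡⟨ cong (λ k → z * pow10 k) (ℤₚ.+-inverseˡ e) ⟩
    z * 1ℚ                        ≡⟨ ℚₚ.*-identityʳ z ⟩
    z                             ∎

  Normalised⇒bounds : ∀ e z → Normalised p e z → threshold e ≤ z × z < threshold (e ℤ.+ ℤ.1ℤ)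
  Normalised⇒bounds e z (lower , upper) =
    subst₂ _≤_ (sym (pow10-+ (+ p) e)) (unscale z e)
      (ℚₚ.*-monoʳ-≤-nonNeg (pow10 e) {{ℚ.nonNegative (pow10-nonNeg e)}} lower) ,
    subst₂ _<_ (unscale z e) (trans (sym (pow10-+ (+ suc p) e)) (cong pow10 1+p+e≡p+[e+1]))
      (ℚₚ.*-monoˡ-<-pos (pow10 e) {{ℚ.positive (pow10-pos e)}} upper)
    where
    1+p+e≡p+[e+1] : + suc p ℤ.+ e ≡ + p ℤ.+ (e ℤ.+ ℤ.1ℤ)
    1+p+e≡p+[e+1] = solve 2 (λ p e → (con ℤ.1ℤ :+ p) :+ e := p :+ (e :+ con ℤ.1ℤ)) refl (+ p) e

  Normalised-unique : ∀ {e e' z} → Normalised p e z → Normalised p e' z → e ≡ e'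
  Normalised-unique {e} {e'} {z} n n' = ℤₚ.≤-antisym (below e e' n n') (below e' e n' n)
    where
    below : ∀ e e' → Normalised p e z → Normalised p e' z → e ℤ.≤ e'
    below e e' n n' = <+1⇒≤ (threshold-cancel-<
      (ℚₚ.≤-<-trans (proj₁ (Normalised⇒bounds e z n)) (proj₂ (Normalised⇒bounds e' z n'))))

  -- Junk value 0 unless z > 0.
  exponent : ∀ {z r} → Rounds p tie z r → ℤ
  exponent (inj₂ (inj₁ (_ , e , _))) = e
  exponent _ = ℤ.0ℤ

  mantissa : ∀ {z r} → Rounds p tie z r → ℕ
  mantissa {z} (inj₂ (inj₁ (_ , e , _))) = roundMant tie false (digits e z)
  mantissa _ = 0

  record RoundedPositive (z r : ℚ) (K : ℕ) (e : ℤ) : Set where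
    field
      r≡K*10^[e+1] : r ≡ ℕ→ℚ K * pow10 (e ℤ.+ ℤ.1ℤ)
      K≤10^p       : K ℕ.≤ 10 ℕ.^ p
      threshold≤z  : threshold e ≤ z
      z<threshold  : z < threshold (e ℤ.+ ℤ.1ℤ)
      threshold≤r  : threshold e ≤ r
      r≤threshold  : r ≤ threshold (e ℤ.+ ℤ.1ℤ)

  Rounds-zero : ∀ {z r} → Rounds p tie z r → z ≡ 0ℚ → r ≡ 0ℚ
  Rounds-zero (inj₁ (_ , r≡0)) _ = r≡0
  Rounds-zero (inj₂ (inj₁ (z>0 , _))) refl = ⊥-elim (ℚₚ.<-irrefl refl z>0)
  Rounds-zero (inj₂ (inj₂ (z<0 , _))) refl = ⊥-elim (ℚₚ.<-irrefl refl z<0)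

  Rounds-positive : ∀ {z r} (h : Rounds p tie z r) → 0ℚ < z → RoundedPositive z r (mantissa h) (exponent h)
  Rounds-positive (inj₁ (refl , _)) z>0 = ⊥-elim (ℚₚ.<-irrefl refl z>0)
  Rounds-positive (inj₂ (inj₂ (z<0 , _))) z>0 = ⊥-elim (ℚₚ.<-asym z<0 z>0)
  Rounds-positive {z} {r} (inj₂ (inj₁ (_ , e , norm , r≡))) _ = record
    { r≡K*10^[e+1] = r≡
    ; K≤10^p = proj₂ K-bounds
    ; threshold≤z = proj₁ (Normalised⇒bounds e z norm)
    ; z<threshold = proj₂ (Normalised⇒bounds e z norm)
    ; threshold≤r = subst₂ _≤_ (trans (sym (pow10-+ (+ p₀) (e ℤ.+ ℤ.1ℤ))) (cong pow10 p₀+[e+1]≡p+e)) (sym r≡)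
                      (*-monoʳ (ℕ→ℚ-mono-≤ (proj₁ K-bounds)))
    ; r≤threshold = subst₂ _≤_ (sym r≡) (sym (pow10-+ (+ p) (e ℤ.+ ℤ.1ℤ))) (*-monoʳ (ℕ→ℚ-mono-≤ (proj₂ K-bounds)))
    }
    where
    D-bounds : 10 ℕ.^ p ℕ.≤ digits e z × digits e z ℕ.< 10 ℕ.^ suc p
    D-bounds = floor-bounds (z * pow10 (ℤ.- e)) (10 ℕ.^ p) (10 ℕ.^ suc p) (proj₁ norm) (proj₂ norm)
    K-bounds : 10 ℕ.^ p₀ ℕ.≤ roundMant tie false (digits e z) × roundMant tie false (digits e z) ℕ.≤ 10 ℕ.^ p
    K-bounds = roundMant-bounds p₀ tie false (digits e z) (proj₁ D-bounds) (proj₂ D-bounds)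
    *-monoʳ : ∀ {a b} → a ≤ b → a * pow10 (e ℤ.+ ℤ.1ℤ) ≤ b * pow10 (e ℤ.+ ℤ.1ℤ)
    *-monoʳ = ℚₚ.*-monoʳ-≤-nonNeg (pow10 (e ℤ.+ ℤ.1ℤ)) {{ℚ.nonNegative (pow10-nonNeg (e ℤ.+ ℤ.1ℤ))}}
    p₀+[e+1]≡p+e : + p₀ ℤ.+ (e ℤ.+ ℤ.1ℤ) ≡ + p ℤ.+ e
    p₀+[e+1]≡p+e = solve 2 (λ p₀ e → p₀ :+ (e :+ con ℤ.1ℤ) := (con ℤ.1ℤ :+ p₀) :+ e) refl (+ p₀) e

  Rounds-pos : ∀ {z r} → Rounds p tie z r → 0ℚ < z → 0ℚ < r
  Rounds-pos h z>0 = ℚₚ.<-≤-trans (pow10-pos (+ p ℤ.+ exponent h)) (RoundedPositive.threshold≤r (Rounds-positive h z>0))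

  Rounds-nonNeg : ∀ {z r} → Rounds p tie z r → 0ℚ ≤ z → 0ℚ ≤ r
  Rounds-nonNeg (inj₁ (_ , refl)) _ = ℚₚ.≤-refl
  Rounds-nonNeg h@(inj₂ (inj₁ (z>0 , _))) _ = ℚₚ.<⇒≤ (Rounds-pos h z>0)
  Rounds-nonNeg (inj₂ (inj₂ (z<0 , _))) z≥0 = ⊥-elim (<⇒≱ z<0 z≥0)

  exponent-≥ : ∀ {z r} (h : Rounds p tie z r) → 0ℚ < z → ∀ k → threshold k ≤ z → k ℤ.≤ exponent h
  exponent-≥ h z>0 k k≤z =
    <+1⇒≤ (threshold-cancel-< (ℚₚ.≤-<-trans k≤z (RoundedPositive.z<threshold (Rounds-positive h z>0))))

  exponent-≤ : ∀ {z r} (h : Rounds p tie z r) → 0ℚ < z → ∀ k → z ≤ threshold k → exponent h ℤ.≤ k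
  exponent-≤ h z>0 k z≤k =
    threshold-cancel-≤ (ℚₚ.≤-trans (RoundedPositive.threshold≤z (Rounds-positive h z>0)) z≤k)

  pow10-*-window : ∀ a z e → (pow10 a * z) * pow10 (ℤ.- (e ℤ.+ a)) ≡ z * pow10 (ℤ.- e)
  pow10-*-window a z e = begin
    (pow10 a * z) * pow10 (ℤ.- (e ℤ.+ a)) ≡⟨ cong (_* pow10 (ℤ.- (e ℤ.+ a))) (ℚₚ.*-comm (pow10 a) z) ⟩
    (z * pow10 a) * pow10 (ℤ.- (e ℤ.+ a)) ≡⟨ ℚₚ.*-assoc z (pow10 a) (pow10 (ℤ.- (e ℤ.+ a))) ⟩
    z * (pow10 a * pow10 (ℤ.- (e ℤ.+ a))) ≡⟨ cong (z *_) (sym (pow10-+ a (ℤ.- (e ℤ.+ a)))) ⟩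
    z * pow10 (a ℤ.+ ℤ.- (e ℤ.+ a))       ≡⟨ cong (λ k → z * pow10 k) (solve 2 (λ a e → a :+ (:- (e :+ a)) := :- e) refl a e) ⟩
    z * pow10 (ℤ.- e)                     ∎

  Rounds-scale : ∀ {z r z' r'} a → z' ≡ pow10 a * z → Rounds p tie z r → Rounds p tie z' r' → 0ℚ ≤ z →
                 r' ≡ pow10 a * r
  Rounds-scale {r' = r'} a z'≡ (inj₁ (z≡0 , r≡0)) h' _ = begin
    r'             ≡⟨ Rounds-zero h' (trans z'≡ (trans (cong (pow10 a *_) z≡0) (ℚₚ.*-zeroʳ (pow10 a)))) ⟩
    0ℚ             ≡⟨ ℚₚ.*-zeroʳ (pow10 a) ⟨
    pow10 a * 0ℚ   ≡⟨ cong (pow10 a *_) r≡0 ⟨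
    pow10 a * _    ∎
  Rounds-scale a _ (inj₂ (inj₂ (z<0 , _))) _ z≥0 = ⊥-elim (<⇒≱ z<0 z≥0)
  Rounds-scale {z} {r} {z'} {r'} a z'≡ (inj₂ (inj₁ (z>0 , e , norm , r≡))) h' _ = scaled h'
    where
    z'>0 : 0ℚ < z'
    z'>0 = subst (0ℚ <_) (sym z'≡) (*-pos (pow10-pos a) z>0)
    window : z' * pow10 (ℤ.- (e ℤ.+ a)) ≡ z * pow10 (ℤ.- e)
    window = trans (cong (_* pow10 (ℤ.- (e ℤ.+ a))) z'≡) (pow10-*-window a z e)
    norm' : Normalised p (e ℤ.+ a) z'
    norm' = subst (λ w → (ℕ→ℚ (10 ℕ.^ p) ≤ w) × (w < ℕ→ℚ (10 ℕ.^ suc p))) (sym window) norm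
    K : ℚ
    K = ℕ→ℚ (roundMant tie false (digits e z))
    scaled : Rounds p tie z' r' → r' ≡ pow10 a * r
    scaled (inj₁ (z'≡0 , _)) = ⊥-elim (ℚₚ.<-irrefl (sym z'≡0) z'>0)
    scaled (inj₂ (inj₂ (z'<0 , _))) = ⊥-elim (ℚₚ.<-asym z'<0 z'>0)
    scaled (inj₂ (inj₁ (_ , e' , norm'' , r'≡))) = begin
      r'                                                                  ≡⟨ r'≡ ⟩
      ℕ→ℚ (roundMant tie false (digits e' z')) * pow10 (e' ℤ.+ ℤ.1ℤ)
        ≡⟨ cong (λ k → ℕ→ℚ (roundMant tie false (digits k z')) * pow10 (k ℤ.+ ℤ.1ℤ))
                (sym (Normalised-unique {e ℤ.+ a} {e'} {z'} norm' norm'')) ⟩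
      ℕ→ℚ (roundMant tie false (digits (e ℤ.+ a) z')) * pow10 ((e ℤ.+ a) ℤ.+ ℤ.1ℤ)
        ≡⟨ cong₂ (λ D k → ℕ→ℚ (roundMant tie false D) * pow10 k) (cong (λ w → ℤ.∣ ℚ.floor w ∣) window)
                 (solve 2 (λ e a → (e :+ a) :+ con ℤ.1ℤ := a :+ (e :+ con ℤ.1ℤ)) refl e a) ⟩
      K * pow10 (a ℤ.+ (e ℤ.+ ℤ.1ℤ))        ≡⟨ *-pow10-+ K a (e ℤ.+ ℤ.1ℤ) ⟩
      pow10 a * (K * pow10 (e ℤ.+ ℤ.1ℤ))    ≡⟨ cong (pow10 a *_) r≡ ⟨
      pow10 a * r                           ∎

sumFin-cong : ∀ {n} {f g : Fin n → ℚ} → (∀ i → f i ≡ g i) → sumFin f ≡ sumFin g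
sumFin-cong {zero} f≗g = refl
sumFin-cong {suc n} f≗g = cong₂ _+_ (f≗g Fin.zero) (sumFin-cong (λ i → f≗g (Fin.suc i)))

sumFin-zero : ∀ {n} (f : Fin n → ℚ) → (∀ i → f i ≡ 0ℚ) → sumFin f ≡ 0ℚ
sumFin-zero {zero} f f≗0 = refl
sumFin-zero {suc n} f f≗0 = cong₂ _+_ (f≗0 Fin.zero) (sumFin-zero (λ i → f (Fin.suc i)) (λ i → f≗0 (Fin.suc i)))

sumFin-*ˡ : ∀ {n} c (f : Fin n → ℚ) → sumFin (λ i → c * f i) ≡ c * sumFin f
sumFin-*ˡ {zero} c f = sym (ℚₚ.*-zeroʳ c)
sumFin-*ˡ {suc n} c f = trans (cong (λ s → c * f Fin.zero + s) (sumFin-*ˡ c (λ i → f (Fin.suc i))))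
  (sym (ℚₚ.*-distribˡ-+ c (f Fin.zero) (sumFin (λ i → f (Fin.suc i)))))

sumFin-nonNeg : ∀ {n} (f : Fin n → ℚ) → (∀ i → 0ℚ ≤ f i) → 0ℚ ≤ sumFin f
sumFin-nonNeg {zero} f f≥0 = ℚₚ.≤-refl
sumFin-nonNeg {suc n} f f≥0 = ℚₚ.+-mono-≤ (f≥0 Fin.zero) (sumFin-nonNeg (λ i → f (Fin.suc i)) (λ i → f≥0 (Fin.suc i)))

term≤sumFin : ∀ {n} (f : Fin n → ℚ) → (∀ i → 0ℚ ≤ f i) → ∀ j → f j ≤ sumFin f
term≤sumFin f f≥0 Fin.zero = subst (_≤ sumFin f) (ℚₚ.+-identityʳ (f Fin.zero))
  (ℚₚ.+-monoʳ-≤ (f Fin.zero) (sumFin-nonNeg (λ i → f (Fin.suc i)) (λ i → f≥0 (Fin.suc i))))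
term≤sumFin f f≥0 (Fin.suc j) = subst (_≤ sumFin f) (ℚₚ.+-identityˡ (f (Fin.suc j)))
  (ℚₚ.+-mono-≤ (f≥0 Fin.zero) (term≤sumFin (λ i → f (Fin.suc i)) (λ i → f≥0 (Fin.suc i)) j))

sumFin-≤ : ∀ {n} (f : Fin n → ℚ) c → (∀ i → f i ≤ c) → sumFin f ≤ ℕ→ℚ n * c
sumFin-≤ {zero} f c f≤c = ℚₚ.≤-reflexive (sym (ℚₚ.*-zeroˡ c))
sumFin-≤ {suc n} f c f≤c =
  ℚₚ.≤-trans (ℚₚ.+-mono-≤ (f≤c Fin.zero) (sumFin-≤ (λ i → f (Fin.suc i)) c (λ i → f≤c (Fin.suc i))))
  (ℚₚ.≤-reflexive (sym (trans (cong (_* c) (ℕ→ℚ-+ 1 n))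
    (trans (ℚₚ.*-distribʳ-+ c 1ℚ (ℕ→ℚ n)) (cong (_+ ℕ→ℚ n * c) (ℚₚ.*-identityˡ c))))))

sumFin-≢0 : ∀ {n} (f : Fin n → ℚ) → sumFin f ≢ 0ℚ → Σ (Fin n) λ i → f i ≢ 0ℚ
sumFin-≢0 {zero} f sum≢0 = ⊥-elim (sum≢0 refl)
sumFin-≢0 {suc n} f sum≢0 with f Fin.zero ℚₚ.≟ 0ℚ
... | no f₀≢0 = Fin.zero , f₀≢0
... | yes f₀≡0 with sumFin-≢0 (λ i → f (Fin.suc i)) (λ rest≡0 → sum≢0 (cong₂ _+_ f₀≡0 rest≡0))
... | i , fᵢ≢0 = Fin.suc i , fᵢ≢0

module _ {d P : ℕ} (A : Matrix (Q' d P)) (s : Q' d P) where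

  mulVec-scale : ∀ c (w w' : Q' d P → ℚ) → (∀ u → A s u * w' u ≡ c * (A s u * w u)) →
                 mulVec A w' s ≡ c * mulVec A w s
  mulVec-scale c w w' h =
    trans (sumFin-cong λ q → trans (sumFin-cong λ i → h (q , i)) (sumFin-*ˡ c (λ i → A s (q , i) * w (q , i))))
          (sumFin-*ˡ c (λ q → sumFin (λ i → A s (q , i) * w (q , i))))

  mulVec-zero : ∀ (w : Q' d P → ℚ) → (∀ u → A s u * w u ≡ 0ℚ) → mulVec A w s ≡ 0ℚ
  mulVec-zero w h = sumFin-zero _ λ q → sumFin-zero _ λ i → h (q , i)

  mulVec-nonNeg : ∀ (w : Q' d P → ℚ) → (∀ u → 0ℚ ≤ A s u * w u) → 0ℚ ≤ mulVec A w s
  mulVec-nonNeg w h = sumFin-nonNeg _ λ q → sumFin-nonNeg _ λ i → h (q , i)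

  term≤mulVec : ∀ (w : Q' d P → ℚ) → (∀ u → 0ℚ ≤ A s u * w u) → ∀ u → A s u * w u ≤ mulVec A w s
  term≤mulVec w h (q , i) = ℚₚ.≤-trans (term≤sumFin _ (λ i → h (q , i)) i)
    (term≤sumFin _ (λ q → sumFin-nonNeg _ λ i → h (q , i)) q)

  mulVec-≤ : ∀ (w : Q' d P → ℚ) c → 0ℚ ≤ c → (∀ u → A s u * w u ≤ c) → mulVec A w s ≤ pow10 (+ (d ℕ.+ P)) * c
  mulVec-≤ w c c≥0 h = ℚₚ.≤-trans (sumFin-≤ _ _ (λ q → sumFin-≤ _ c (λ i → h (q , i))))
    (subst (ℕ→ℚ d * (ℕ→ℚ P * c) ≤_) regroup
      (*-mono-≤ (ℕ→ℚ-nonNeg d) (*-nonNeg (ℕ→ℚ-nonNeg P) c≥0) (ℕ→ℚ≤pow10 d)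
                (ℚₚ.*-monoʳ-≤-nonNeg c {{ℚ.nonNegative c≥0}} (ℕ→ℚ≤pow10 P))))
    where
    regroup : pow10 (+ d) * (pow10 (+ P) * c) ≡ pow10 (+ (d ℕ.+ P)) * c
    regroup = trans (sym (ℚₚ.*-assoc (pow10 (+ d)) (pow10 (+ P)) c)) (cong (_* c) (sym (pow10-+ (+ d) (+ P))))

  mulVec-≢0 : ∀ (w : Q' d P → ℚ) → mulVec A w s ≢ 0ℚ → Σ (Q' d P) λ u → A s u * w u ≢ 0ℚ
  mulVec-≢0 w mulVec≢0 with sumFin-≢0 _ mulVec≢0
  ... | q , row≢0 with sumFin-≢0 _ row≢0
  ... | i , term≢0 = (q , i) , term≢0

-- Walks and simple cycles

data Walk {V : Set} (A : Matrix V) : ℕ → V → V → Set where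
  []  : ∀ {u} → Walk A 0 u u
  _∷_ : ∀ {u v w n} → Edge A u v → Walk A n v w → Walk A (suc n) u w

module _ {V : Set} {A : Matrix V} where

  _++ʷ_ : ∀ {m n u v w} → Walk A m u v → Walk A n v w → Walk A (m ℕ.+ n) u w
  [] ++ʷ w' = w'
  (e ∷ w) ++ʷ w' = e ∷ (w ++ʷ w')

  replicateʷ : ∀ {ℓ u} n → Walk A ℓ u u → Walk A (n ℕ.* ℓ) u u
  replicateʷ zero w = []
  replicateʷ (suc n) w = w ++ʷ replicateʷ n w

  Star⇒Walk : ∀ {u v} → Star (Edge A) u v → Σ ℕ λ ℓ → Walk A ℓ u v
  Star⇒Walk ε = 0 , []
  Star⇒Walk (e ◅ s) = suc (proj₁ (Star⇒Walk s)) , e ∷ proj₂ (Star⇒Walk s)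

  Walk⇒Star : ∀ {ℓ u v} → Walk A ℓ u v → Star (Edge A) u v
  Walk⇒Star [] = ε
  Walk⇒Star (e ∷ w) = e ◅ Walk⇒Star w

  -- Junk value: the last vertex beyond the end of the walk.
  vertexAt : ∀ {ℓ u v} → Walk A ℓ u v → ℕ → V
  vertexAt {u = u} [] n = u
  vertexAt {u = u} (e ∷ w) zero = u
  vertexAt (e ∷ w) (suc n) = vertexAt w n

  vertexAt-0 : ∀ {ℓ u v} (w : Walk A ℓ u v) → vertexAt w 0 ≡ u
  vertexAt-0 [] = refl
  vertexAt-0 (e ∷ w) = refl

  vertexAt-end : ∀ {ℓ u v} (w : Walk A ℓ u v) → vertexAt w ℓ ≡ v
  vertexAt-end [] = refl
  vertexAt-end (e ∷ w) = vertexAt-end w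

  vertexAt-edge : ∀ {ℓ u v} (w : Walk A ℓ u v) n → n ℕ.< ℓ → Edge A (vertexAt w n) (vertexAt w (suc n))
  vertexAt-edge (e ∷ w) zero _ = subst (Edge A _) (sym (vertexAt-0 w)) e
  vertexAt-edge (e ∷ w) (suc n) (ℕ.s≤s n<ℓ) = vertexAt-edge w n n<ℓ

  reach-vertexAt : ∀ {ℓ u v} (w : Walk A ℓ u v) n → Star (Edge A) u (vertexAt w n)
  reach-vertexAt [] n = ε
  reach-vertexAt (e ∷ w) zero = ε
  reach-vertexAt (e ∷ w) (suc n) = e ◅ reach-vertexAt w n

  vertexAt-reach : ∀ {ℓ u v} (w : Walk A ℓ u v) n → Star (Edge A) (vertexAt w n) v
  vertexAt-reach [] n = ε
  vertexAt-reach (e ∷ w) zero = e ◅ Walk⇒Star w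
  vertexAt-reach (e ∷ w) (suc n) = vertexAt-reach w n

least : (Q : ℕ → Set) → (∀ n → Dec (Q n)) → ∀ n → Q n →
        Σ ℕ λ j → j ℕ.≤ n × Q j × (∀ k → k ℕ.< j → ¬ Q k)
least Q Q? = <-rec Least search
  where
  Least : ℕ → Set
  Least n = Q n → Σ ℕ λ j → j ℕ.≤ n × Q j × (∀ k → k ℕ.< j → ¬ Q k)
  search : ∀ n → (∀ {m} → m ℕ.< n → Least m) → Least n
  search n below qn with Finₚ.any? {n} (λ i → Q? (toℕ i))
  ... | no none = n , ℕₚ.≤-refl , qn , λ k k<n qk → none (Fin.fromℕ< k<n , subst Q (sym (Finₚ.toℕ-fromℕ< k<n)) qk)
  ... | yes (i , qi) with below (Finₚ.toℕ<n i) qi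
  ... | j , j≤i , qj , minimal = j , ℕₚ.≤-trans j≤i (ℕₚ.<⇒≤ (Finₚ.toℕ<n i)) , qj , minimal

isNext⇒ : ∀ {k} (i j : Fin k) → isNext k i j ≡ true → toℕ j ≡ suc (toℕ i) ⊎ (toℕ j ≡ 0 × suc (toℕ i) ≡ k)
isNext⇒ {k} i j h with Equivalence.to Boolₚ.T-∨ (Equivalence.from Boolₚ.T-≡ h)
... | inj₁ j≡1+i = inj₁ (ℕₚ.≡ᵇ⇒≡ (toℕ j) (suc (toℕ i)) j≡1+i)
... | inj₂ wraps with Equivalence.to Boolₚ.T-∧ wraps
... | j≡0 , 1+i≡k = inj₂ (ℕₚ.≡ᵇ⇒≡ (toℕ j) 0 j≡0 , ℕₚ.≡ᵇ⇒≡ (suc (toℕ i)) k 1+i≡k)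

⇒isNext : ∀ {k} (i j : Fin k) → toℕ j ≡ suc (toℕ i) ⊎ (toℕ j ≡ 0 × suc (toℕ i) ≡ k) → isNext k i j ≡ true
⇒isNext {k} i j h = Equivalence.to Boolₚ.T-≡ (Equivalence.from Boolₚ.T-∨ (decide h))
  where
  decide : toℕ j ≡ suc (toℕ i) ⊎ (toℕ j ≡ 0 × suc (toℕ i) ≡ k) →
           T (toℕ j ℕ.≡ᵇ suc (toℕ i)) ⊎ T ((toℕ j ℕ.≡ᵇ 0) ∧ (suc (toℕ i) ℕ.≡ᵇ k))
  decide (inj₁ j≡1+i) = inj₁ (ℕₚ.≡⇒≡ᵇ (toℕ j) (suc (toℕ i)) j≡1+i)
  decide (inj₂ (j≡0 , 1+i≡k)) =
    inj₂ (Equivalence.from Boolₚ.T-∧ (ℕₚ.≡⇒≡ᵇ (toℕ j) 0 j≡0 , ℕₚ.≡⇒≡ᵇ (suc (toℕ i)) k 1+i≡k))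

module _ {d : ℕ} (M : Matrix (Fin d)) (ν : ℕ → Fin d) where

  segment : ∀ k i → (∀ n → n ℕ.< k → Edge M (ν (i ℕ.+ n)) (ν (suc (i ℕ.+ n)))) → Walk M k (ν i) (ν (i ℕ.+ k))
  segment zero i _ = subst (Walk M 0 (ν i)) (cong ν (sym (ℕₚ.+-identityʳ i))) []
  segment (suc k) i edges =
    first ∷ subst (Walk M k (ν (suc i))) (cong ν (sym (ℕₚ.+-suc i k)))
                  (segment k (suc i) λ n n<k → subst₂ (λ a b → Edge M (ν a) (ν b)) (ℕₚ.+-suc i n) (cong suc (ℕₚ.+-suc i n))
                                                      (edges (suc n) (ℕ.s≤s n<k)))
    where
    first : Edge M (ν i) (ν (suc i))
    first = subst₂ (λ a b → Edge M (ν a) (ν b)) (ℕₚ.+-identityʳ i) (cong suc (ℕₚ.+-identityʳ i)) (edges 0 (ℕ.s≤s ℕ.z≤n))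

  Repeats : ℕ → Set
  Repeats j = Σ (Fin j) λ i → ν (toℕ i) ≡ ν j

  repeats? : ∀ j → Dec (Repeats j)
  repeats? j = Finₚ.any? (λ (i : Fin j) → ν (toℕ i) Finₚ.≟ ν j)

  -- Cut the closed walk ν 0, …, ν ℓ at the first vertex ν j that repeats an earlier one ν i.
  closedWalk⇒simpleCycle : ∀ ℓ → 1 ℕ.≤ ℓ → (∀ n → n ℕ.< ℓ → Edge M (ν n) (ν (suc n))) → ν 0 ≡ ν ℓ →
    Σ ℕ λ i → Σ ℕ λ k → i ℕ.+ k ℕ.≤ ℓ × SimpleCycle M k × ν (i ℕ.+ k) ≡ ν i
  closedWalk⇒simpleCycle ℓ ℓ≥1 edges closed
    with least Repeats repeats? ℓ (Fin.fromℕ< ℓ≥1 , trans (cong ν (Finₚ.toℕ-fromℕ< ℓ≥1)) closed)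
  ... | j , j≤ℓ , (i′ , νi≡νj) , minimal = i , k , i+k≤ℓ , (k≥1 , c , c-injective , c-edges) , returns
    where
    i = toℕ i′
    k = j ℕ.∸ i
    i+k≡j : i ℕ.+ k ≡ j
    i+k≡j = ℕₚ.m+[n∸m]≡n (ℕₚ.<⇒≤ (Finₚ.toℕ<n i′))
    i+k≤ℓ : i ℕ.+ k ℕ.≤ ℓ
    i+k≤ℓ = subst (ℕ._≤ ℓ) (sym i+k≡j) j≤ℓ
    k≥1 : 1 ℕ.≤ k
    k≥1 = ℕₚ.m<n⇒0<n∸m (Finₚ.toℕ<n i′)
    returns : ν (i ℕ.+ k) ≡ ν i
    returns = trans (cong ν i+k≡j) (sym νi≡νj)
    c : Fin k → Fin d
    c m = ν (i ℕ.+ toℕ m)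
    i+m<j : ∀ (m : Fin k) → i ℕ.+ toℕ m ℕ.< j
    i+m<j m = subst (i ℕ.+ toℕ m ℕ.<_) i+k≡j (ℕₚ.+-monoʳ-< i (Finₚ.toℕ<n m))
    distinct : ∀ (m m' : Fin k) → toℕ m ℕ.< toℕ m' → c m ≢ c m'
    distinct m m' m<m' cm≡cm' = minimal (i ℕ.+ toℕ m') (i+m<j m')
      (Fin.fromℕ< (ℕₚ.+-monoʳ-< i m<m') , trans (cong ν (Finₚ.toℕ-fromℕ< (ℕₚ.+-monoʳ-< i m<m'))) cm≡cm')
    c-injective : ∀ {m m'} → c m ≡ c m' → m ≡ m'
    c-injective {m} {m'} cm≡cm' with ℕₚ.<-cmp (toℕ m) (toℕ m')
    ... | tri< m<m' _ _ = ⊥-elim (distinct m m' m<m' cm≡cm')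
    ... | tri≈ _ m≡m' _ = Finₚ.toℕ-injective m≡m'
    ... | tri> _ _ m>m' = ⊥-elim (distinct m' m m>m' (sym cm≡cm'))
    edge-after : ∀ (m : Fin k) → Edge M (c m) (ν (i ℕ.+ suc (toℕ m)))
    edge-after m = subst (λ a → Edge M (c m) (ν a)) (sym (ℕₚ.+-suc i (toℕ m)))
                         (edges (i ℕ.+ toℕ m) (ℕₚ.<-≤-trans (i+m<j m) j≤ℓ))
    c-edges : ∀ m m' → isNext k m m' ≡ true → Edge M (c m) (c m')
    c-edges m m' next with isNext⇒ m m' next
    ... | inj₁ m'≡1+m = subst (λ a → Edge M (c m) (ν (i ℕ.+ a))) (sym m'≡1+m) (edge-after m)
    ... | inj₂ (m'≡0 , 1+m≡k) = subst (Edge M (c m)) wraps (edge-after m)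
      where
      wraps : ν (i ℕ.+ suc (toℕ m)) ≡ c m'
      wraps = trans (cong (λ a → ν (i ℕ.+ a)) 1+m≡k)
                (trans returns (cong ν (sym (trans (cong (i ℕ.+_) m'≡0) (ℕₚ.+-identityʳ i)))))

-- Phases in the annotated system

module _ (P : ℕ) .{{_ : ℕ.NonZero P}} where

  toℕ%P : ∀ (i : Fin P) → toℕ i % P ≡ toℕ i
  toℕ%P i = ℕ.m<n⇒m%n≡m (Finₚ.toℕ<n i)

  [i+0]%P≡i : ∀ (i : Fin P) → (toℕ i ℕ.+ 0) % P ≡ toℕ i
  [i+0]%P≡i i = trans (cong (_% P) (ℕₚ.+-identityʳ (toℕ i))) (toℕ%P i)

  isNext⇒% : ∀ (i j : Fin P) → isNext P i j ≡ true → toℕ j ≡ suc (toℕ i) % P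
  isNext⇒% i j next with isNext⇒ i j next
  ... | inj₁ j≡1+i = trans j≡1+i (sym (ℕ.m<n⇒m%n≡m (subst (ℕ._< P) j≡1+i (Finₚ.toℕ<n j))))
  ... | inj₂ (j≡0 , 1+i≡P) = trans j≡0 (sym (trans (cong (_% P) 1+i≡P) (ℕ.n%n≡0 P)))

  %⇒isNext : ∀ (i j : Fin P) → toℕ j ≡ suc (toℕ i) % P → isNext P i j ≡ true
  %⇒isNext i j j≡[1+i]%P = ⇒isNext i j (cases (ℕₚ.m≤n⇒m<n∨m≡n (Finₚ.toℕ<n i)))
    where
    cases : suc (toℕ i) ℕ.< P ⊎ suc (toℕ i) ≡ P → toℕ j ≡ suc (toℕ i) ⊎ (toℕ j ≡ 0 × suc (toℕ i) ≡ P)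
    cases (inj₁ 1+i<P) = inj₁ (trans j≡[1+i]%P (ℕ.m<n⇒m%n≡m 1+i<P))
    cases (inj₂ 1+i≡P) = inj₂ (trans j≡[1+i]%P (trans (cong (_% P) 1+i≡P) (ℕ.n%n≡0 P)) , 1+i≡P)

  module _ {d : ℕ} (M : Matrix (Fin d)) where

    M′-entry : ∀ v u → M′ P M v u ≡ 0ℚ ⊎ M′ P M v u ≡ M (proj₁ v) (proj₁ u)
    M′-entry (q , j) (q' , i) with isNext P i j
    ... | true = inj₂ refl
    ... | false = inj₁ refl

    M′-edge⇒ : ∀ u v → Edge (M′ P M) u v → isNext P (proj₂ u) (proj₂ v) ≡ true × Edge M (proj₁ u) (proj₁ v)
    M′-edge⇒ (q , i) (q' , j) e with isNext P i j
    ... | true = refl , e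
    ... | false = ⊥-elim (e refl)

    lift-edge : ∀ {q i q' j} → isNext P i j ≡ true → Edge M q q' → Edge (M′ P M) (q , i) (q' , j)
    lift-edge {q} {i} {q'} {j} next e rewrite next = e

    Walk-phase : ∀ {ℓ q i q' j} → Walk (M′ P M) ℓ (q , i) (q' , j) → toℕ j ≡ (toℕ i ℕ.+ ℓ) % P
    Walk-phase {i = i} [] = sym ([i+0]%P≡i i)
    Walk-phase {suc ℓ} {q} {i} {j = j} (_∷_ {v = (q₁ , i₁)} e w) = begin
      toℕ j                      ≡⟨ Walk-phase w ⟩
      (toℕ i₁ ℕ.+ ℓ) % P
        ≡⟨ cong (λ a → (a ℕ.+ ℓ) % P) (isNext⇒% i i₁ (proj₁ (M′-edge⇒ (q , i) (q₁ , i₁) e))) ⟩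
      (suc (toℕ i) % P ℕ.+ ℓ) % P ≡⟨ [m%n+o]%n≡[m+o]%n (suc (toℕ i)) ℓ P ⟩
      (suc (toℕ i) ℕ.+ ℓ) % P    ≡⟨ cong (_% P) (sym (ℕₚ.+-suc (toℕ i) ℓ)) ⟩
      (toℕ i ℕ.+ suc ℓ) % P      ∎

    x′-entry : ∀ (x : Fin d → ℚ) q i → x′ P x (q , i) ≡ 0ℚ ⊎ (toℕ i ≡ 0 × x′ P x (q , i) ≡ x q)
    x′-entry x q i with toℕ i ℕ.≡ᵇ 0 in i≡ᵇ0
    ... | true = inj₂ (ℕₚ.≡ᵇ⇒≡ (toℕ i) 0 (subst T (sym i≡ᵇ0) _) , refl)
    ... | false = inj₁ refl

    lift : ∀ {ℓ q q'} → Walk M ℓ q q' → ∀ i j → toℕ j ≡ (toℕ i ℕ.+ ℓ) % P → Walk (M′ P M) ℓ (q , i) (q' , j)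
    lift {q = q} [] i j j≡i = subst (λ k → Walk (M′ P M) 0 (q , i) (q , k))
                                    (Finₚ.toℕ-injective (sym (trans j≡i ([i+0]%P≡i i)))) []
    lift {suc ℓ} (e ∷ w) i j j≡i+1+ℓ =
      lift-edge {i = i} {j = next} (%⇒isNext i next (Finₚ.toℕ-fromℕ< _)) e ∷ lift w next j (begin
        toℕ j                         ≡⟨ j≡i+1+ℓ ⟩
        (toℕ i ℕ.+ suc ℓ) % P         ≡⟨ cong (_% P) (ℕₚ.+-suc (toℕ i) ℓ) ⟩
        (suc (toℕ i) ℕ.+ ℓ) % P       ≡⟨ [m%n+o]%n≡[m+o]%n (suc (toℕ i)) ℓ P ⟨
        (suc (toℕ i) % P ℕ.+ ℓ) % P   ≡⟨ cong (λ a → (a ℕ.+ ℓ) % P) (Finₚ.toℕ-fromℕ< _) ⟨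
        (toℕ next ℕ.+ ℓ) % P          ∎)
      where
      next : Fin P
      next = suc (toℕ i) ℕ.mod P

Argmax : {V : Set} → (V → Set) → (V → ℤ) → Set
Argmax {V} Q f = Σ V λ v → Q v × (∀ w → Q w → f w ℤ.≤ f v)

argmax-Fin : ∀ {n} (Q : Fin n → Set) → (∀ i → Dec (Q i)) → (f : Fin n → ℤ) → (∀ i → ¬ Q i) ⊎ Argmax Q f
argmax-Fin {zero} Q Q? f = inj₁ λ ()
argmax-Fin {suc n} Q Q? f with argmax-Fin (λ i → Q (Fin.suc i)) (λ i → Q? (Fin.suc i)) (λ i → f (Fin.suc i)) | Q? Fin.zero
... | inj₁ none | no ¬q₀ = inj₁ λ { Fin.zero → ¬q₀ ; (Fin.suc i) → none i }
... | inj₁ none | yes q₀ = inj₂ (Fin.zero , q₀ , λ { Fin.zero _ → ℤₚ.≤-refl ; (Fin.suc j) qj → ⊥-elim (none j qj) })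
... | inj₂ (i , qi , max) | no ¬q₀ = inj₂ (Fin.suc i , qi , λ { Fin.zero q₀ → ⊥-elim (¬q₀ q₀) ; (Fin.suc j) qj → max j qj })
... | inj₂ (i , qi , max) | yes q₀ with f Fin.zero ℤₚ.≤? f (Fin.suc i)
...   | yes f₀≤fi = inj₂ (Fin.suc i , qi , λ { Fin.zero _ → f₀≤fi ; (Fin.suc j) qj → max j qj })
...   | no f₀≰fi = inj₂ (Fin.zero , q₀ , λ { Fin.zero _ → ℤₚ.≤-refl
                                            ; (Fin.suc j) qj → ℤₚ.≤-trans (max j qj) (ℤₚ.<⇒≤ (ℤₚ.≰⇒> f₀≰fi)) })

argmax-× : ∀ {d P} (Q : Fin d × Fin P → Set) → (∀ v → Dec (Q v)) → (f : Fin d × Fin P → ℤ) →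
           (∀ v → ¬ Q v) ⊎ Argmax Q f
argmax-× {d} {P} Q Q? f with argmax-Fin (λ k → Q (Fin.remQuot P k)) (λ k → Q? (Fin.remQuot P k)) (λ k → f (Fin.remQuot P k))
... | inj₁ none = inj₁ λ (q , i) → none (Fin.combine q i) ∘′ subst Q (sym (Finₚ.remQuot-combine q i))
... | inj₂ (k , qk , max) = inj₂ (Fin.remQuot P k , qk , λ (q , i) qv →
        subst (λ v → f v ℤ.≤ f (Fin.remQuot P k)) (Finₚ.remQuot-combine q i)
              (max (Fin.combine q i) (subst Q (sym (Finₚ.remQuot-combine q i)) qv)))

any?-× : ∀ {d P} (Q : Fin d × Fin P → Set) → (∀ v → Dec (Q v)) → Dec (Σ (Fin d × Fin P) Q)
any?-× Q Q? with Finₚ.any? (λ q → Finₚ.any? (λ i → Q? (q , i)))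
... | yes (q , i , qv) = yes ((q , i) , qv)
... | no none = no λ ((q , i) , qv) → none (q , i , qv)

fromDigits : ∀ B {n} → (Fin n → ℕ) → ℕ
fromDigits B {zero} g = 0
fromDigits B {suc n} g = g Fin.zero ℕ.+ B ℕ.* fromDigits B (λ i → g (Fin.suc i))

fromDigits-< : ∀ B {n} (g : Fin n → ℕ) → (∀ i → g i ℕ.< B) → fromDigits B g ℕ.< B ℕ.^ n
fromDigits-< B {zero} g g<B = ℕ.s≤s ℕ.z≤n
fromDigits-< B {suc n} g g<B = ℕₚ.<-≤-trans
  (subst (fromDigits B g ℕ.<_) (sym (ℕₚ.*-suc B rest)) (ℕₚ.+-monoˡ-< (B ℕ.* rest) (g<B Fin.zero)))
  (ℕₚ.*-monoʳ-≤ B (fromDigits-< B (λ i → g (Fin.suc i)) (λ i → g<B (Fin.suc i))))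
  where rest = fromDigits B (λ i → g (Fin.suc i))

fromDigits-injective : ∀ B {n} (g g' : Fin n → ℕ) → (∀ i → g i ℕ.< B) → (∀ i → g' i ℕ.< B) →
                       fromDigits B g ≡ fromDigits B g' → ∀ i → g i ≡ g' i
fromDigits-injective B g g' g<B g'<B eq Fin.zero = proj₁ (digit-unique (g<B Fin.zero) (g'<B Fin.zero) eq)
fromDigits-injective B g g' g<B g'<B eq (Fin.suc i) =
  fromDigits-injective B (λ i → g (Fin.suc i)) (λ i → g' (Fin.suc i)) (λ i → g<B (Fin.suc i)) (λ i → g'<B (Fin.suc i))
    (proj₂ (digit-unique (g<B Fin.zero) (g'<B Fin.zero) eq)) i

module _ {d P : ℕ} where

  fromDigits-× : ∀ B → (Fin d × Fin P → ℕ) → ℕ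
  fromDigits-× B g = fromDigits B (λ k → g (Fin.remQuot P k))

  fromDigits-×-< : ∀ B (g : Fin d × Fin P → ℕ) → (∀ v → g v ℕ.< B) → fromDigits-× B g ℕ.< B ℕ.^ (d ℕ.* P)
  fromDigits-×-< B g g<B = fromDigits-< B _ (λ k → g<B (Fin.remQuot P k))

  fromDigits-×-injective : ∀ B (g g' : Fin d × Fin P → ℕ) → (∀ v → g v ℕ.< B) → (∀ v → g' v ℕ.< B) →
                           fromDigits-× B g ≡ fromDigits-× B g' → ∀ v → g v ≡ g' v
  fromDigits-×-injective B g g' g<B g'<B eq (q , i) = subst (λ v → g v ≡ g' v) (Finₚ.remQuot-combine q i)
    (fromDigits-injective B _ _ (λ k → g<B (Fin.remQuot P k)) (λ k → g'<B (Fin.remQuot P k)) eq (Fin.combine q i))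

-- The rounded orbit on a top component

module Orbit (p₀ : ℕ) (tie : TieRule) {d : ℕ} (M : Matrix (Fin d)) (x : Fin d → ℚ)
  (M≥0 : ∀ q q' → 0ℚ ≤ M q q') (x≥0 : ∀ q → 0ℚ ≤ x q)
  (P : ℕ) .{{_ : ℕ.NonZero P}}
  (y : ℕ → Q' d P → ℚ) (orbit : IsRoundedOrbit (suc p₀) tie (M′ P M) (x′ P x) y)
  (S : Q' d P → Bool) (top : IsTop (M′ P M) S)
  (κ : ℕ) (M-bounded : Pow10Bounded M κ)
  where

  open Rounding p₀ tie
  open ℤ-Solver.+-*-Solver using (solve; _:+_; :-_; _:=_)

  V : Set
  V = Q' d P

  A : Matrix V
  A = M′ P M

  unrounded : ℕ → V → ℚ
  unrounded zero = x′ P x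
  unrounded (suc t) = mulVec A (y t)

  rounds : ∀ t s → Rounds p tie (unrounded t s) (y t s)
  rounds zero = proj₁ orbit
  rounds (suc t) = proj₂ orbit t

  exp : ℕ → V → ℤ
  exp t s = exponent (rounds t s)

  mant : ℕ → V → ℕ
  mant t s = mantissa (rounds t s)

  A≥0 : ∀ v u → 0ℚ ≤ A v u
  A≥0 v u = [ (λ A≡0 → ℚₚ.≤-reflexive (sym A≡0)) , (λ A≡M → subst (0ℚ ≤_) (sym A≡M) (M≥0 _ _)) ]′ (M′-entry P M v u)

  A≤10^κ : ∀ v u → A v u ≤ pow10 (+ κ)
  A≤10^κ v u = [ (λ A≡0 → subst (_≤ pow10 (+ κ)) (sym A≡0) (pow10-nonNeg (+ κ)))
               , (λ A≡M → subst (_≤ pow10 (+ κ)) (sym A≡M) (proj₁ M-bounded _ _)) ]′ (M′-entry P M v u)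

  10^-κ≤A : ∀ v u → A v u ≢ 0ℚ → pow10 (ℤ.- (+ κ)) ≤ A v u
  10^-κ≤A v u A≢0 = [ (λ A≡0 → ⊥-elim (A≢0 A≡0))
                    , (λ A≡M → subst (pow10 (ℤ.- (+ κ)) ≤_) (sym A≡M) (proj₂ M-bounded _ _ (λ M≡0 → A≢0 (trans A≡M M≡0)))) ]′
                    (M′-entry P M v u)

  x′≥0 : ∀ s → 0ℚ ≤ x′ P x s
  x′≥0 (q , i) = [ (λ x′≡0 → ℚₚ.≤-reflexive (sym x′≡0)) , (λ (_ , x′≡x) → subst (0ℚ ≤_) (sym x′≡x) (x≥0 q)) ]′
                 (x′-entry P M x q i)

  y≥0 : ∀ t s → 0ℚ ≤ y t s
  unrounded≥0 : ∀ t s → 0ℚ ≤ unrounded t s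
  y≥0 t s = Rounds-nonNeg (rounds t s) (unrounded≥0 t s)
  unrounded≥0 zero s = x′≥0 s
  unrounded≥0 (suc t) s = mulVec-nonNeg A s (y t) (λ u → *-nonNeg (A≥0 s u) (y≥0 t u))

  unrounded>0 : ∀ t s → y t s ≢ 0ℚ → 0ℚ < unrounded t s
  unrounded>0 t s y≢0 = ≢0⇒>0 (unrounded≥0 t s) (λ z≡0 → y≢0 (Rounds-zero (rounds t s) z≡0))

  positive : ∀ t s → y t s ≢ 0ℚ → RoundedPositive (unrounded t s) (y t s) (mant t s) (exp t s)
  positive t s y≢0 = Rounds-positive (rounds t s) (unrounded>0 t s y≢0)

  phase : ∀ t {q i} → y t (q , i) ≢ 0ℚ → toℕ i ≡ t % P
  phase zero {q} {i} y≢0 = trans (phase-0 (x′-entry P M x q i)) (sym (ℕ.m<n⇒m%n≡m (ℕ.>-nonZero⁻¹ P)))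
    where
    phase-0 : x′ P x (q , i) ≡ 0ℚ ⊎ (toℕ i ≡ 0 × x′ P x (q , i) ≡ x q) → toℕ i ≡ 0
    phase-0 (inj₁ x′≡0) = ⊥-elim (y≢0 (Rounds-zero (rounds 0 (q , i)) x′≡0))
    phase-0 (inj₂ (i≡0 , _)) = i≡0
  phase (suc t) {q} {i} y≢0 with mulVec-≢0 A (q , i) (y t) (λ z≡0 → y≢0 (Rounds-zero (rounds (suc t) (q , i)) z≡0))
  ... | (q' , i') , term≢0 = begin
    toℕ i                      ≡⟨ isNext⇒% P i' i (proj₁ (M′-edge⇒ P M (q' , i') (q , i) (proj₁ factors≢0))) ⟩
    suc (toℕ i') % P           ≡⟨ cong (λ a → suc a % P) (phase t (proj₂ factors≢0)) ⟩
    suc (t % P) % P            ≡⟨ cong (_% P) (ℕₚ.+-comm 1 (t % P)) ⟩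
    (t % P ℕ.+ 1) % P          ≡⟨ [m%n+o]%n≡[m+o]%n t 1 P ⟩
    (t ℕ.+ 1) % P              ≡⟨ cong (_% P) (ℕₚ.+-comm t 1) ⟩
    suc t % P                  ∎
    where
    factors≢0 : A (q , i) (q' , i') ≢ 0ℚ × y t (q' , i') ≢ 0ℚ
    factors≢0 = *≢0⇒ {A (q , i) (q' , i')} {y t (q' , i')} term≢0

  edge-step : ∀ t {u v} → Edge A u v → y t u ≢ 0ℚ → y (suc t) v ≢ 0ℚ × exp t u ℤ.≤ exp (suc t) v ℤ.+ + κ
  edge-step t {u} {v} Avu≢0 yu≢0 = y≢0 , exp-bound
    where
    term≤ : A v u * y t u ≤ unrounded (suc t) v
    term≤ = term≤mulVec A v (y t) (λ w → *-nonNeg (A≥0 v w) (y≥0 t w)) u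
    z>0 : 0ℚ < unrounded (suc t) v
    z>0 = ℚₚ.<-≤-trans (*-pos (≢0⇒>0 (A≥0 v u) Avu≢0) (≢0⇒>0 (y≥0 t u) yu≢0)) term≤
    y≢0 : y (suc t) v ≢ 0ℚ
    y≢0 y≡0 = ℚₚ.<-irrefl (sym y≡0) (Rounds-pos (rounds (suc t) v) z>0)
    threshold≤z : threshold (exp t u ℤ.+ ℤ.- (+ κ)) ≤ unrounded (suc t) v
    threshold≤z = ℚₚ.≤-trans (subst (_≤ A v u * y t u) (pow10-*-threshold (ℤ.- (+ κ)) (exp t u))
      (*-mono-≤ (pow10-nonNeg (ℤ.- (+ κ))) (pow10-nonNeg (+ p ℤ.+ exp t u)) (10^-κ≤A v u Avu≢0)
                (RoundedPositive.threshold≤r (positive t u yu≢0)))) term≤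
    exp-bound : exp t u ℤ.≤ exp (suc t) v ℤ.+ + κ
    exp-bound = subst (ℤ._≤ exp (suc t) v ℤ.+ + κ) (solve 2 (λ e k → (e :+ (:- k)) :+ k := e) refl (exp t u) (+ κ))
      (ℤₚ.+-monoˡ-≤ (+ κ) (exponent-≥ (rounds (suc t) v) z>0 (exp t u ℤ.+ ℤ.- (+ κ)) threshold≤z))

  walk-step : ∀ t {ℓ u v} → Walk A ℓ u v → y t u ≢ 0ℚ →
              y (t ℕ.+ ℓ) v ≢ 0ℚ × exp t u ℤ.≤ exp (t ℕ.+ ℓ) v ℤ.+ + (ℓ ℕ.* κ)
  walk-step t {u = u} [] yu≢0 = subst (λ t' → y t' u ≢ 0ℚ × exp t u ℤ.≤ exp t' u ℤ.+ + 0) (sym (ℕₚ.+-identityʳ t))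
    (yu≢0 , ℤₚ.≤-reflexive (sym (ℤₚ.+-identityʳ (exp t u))))
  walk-step t {suc ℓ} {u} {v} (_∷_ {v = u₁} e w) yu≢0 =
    subst (λ t' → y t' v ≢ 0ℚ × exp t u ℤ.≤ exp t' v ℤ.+ + (suc ℓ ℕ.* κ)) (sym (ℕₚ.+-suc t ℓ))
      (proj₁ rest , ℤₚ.≤-trans (proj₂ first) (ℤₚ.≤-trans (ℤₚ.+-monoˡ-≤ (+ κ) (proj₂ rest)) (ℤₚ.≤-reflexive regroup)))
    where
    first : y (suc t) u₁ ≢ 0ℚ × exp t u ℤ.≤ exp (suc t) u₁ ℤ.+ + κ
    first = edge-step t e yu≢0
    rest : y (suc t ℕ.+ ℓ) v ≢ 0ℚ × exp (suc t) u₁ ℤ.≤ exp (suc t ℕ.+ ℓ) v ℤ.+ + (ℓ ℕ.* κ)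
    rest = walk-step (suc t) w (proj₁ first)
    e' : ℤ
    e' = exp (suc t ℕ.+ ℓ) v
    regroup : (e' ℤ.+ + (ℓ ℕ.* κ)) ℤ.+ + κ ≡ e' ℤ.+ + (suc ℓ ℕ.* κ)
    regroup = trans (ℤₚ.+-assoc e' (+ (ℓ ℕ.* κ)) (+ κ))
      (cong (λ k → e' ℤ.+ k) (trans (sym (ℤₚ.pos-+ (ℓ ℕ.* κ) κ)) (cong +_ (ℕₚ.+-comm (ℓ ℕ.* κ) κ))))

  row-of-S : ∀ {v} → S v ≡ true → ∀ u → S u ≡ true ⊎ A v u ≡ 0ℚ
  row-of-S {v} v∈S u = decide (A v u ℚₚ.≟ 0ℚ)
    where
    decide : Dec (A v u ≡ 0ℚ) → S u ≡ true ⊎ A v u ≡ 0ℚ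
    decide (yes Avu≡0) = inj₂ Avu≡0
    decide (no Avu≢0) = inj₁ (top u v Avu≢0 v∈S)

  ExpBound : ℕ → ℤ → Set
  ExpBound t G = ∀ s → S s ≡ true → y t s ≢ 0ℚ → exp t s ℤ.≤ G

  growth : ℕ
  growth = 1 ℕ.+ κ ℕ.+ (d ℕ.+ P)

  y≤threshold : ∀ t G → ExpBound t G → ∀ s → S s ≡ true → y t s ≤ threshold (G ℤ.+ ℤ.1ℤ)
  y≤threshold t G bound s s∈S = decide (y t s ℚₚ.≟ 0ℚ)
    where
    decide : Dec (y t s ≡ 0ℚ) → y t s ≤ threshold (G ℤ.+ ℤ.1ℤ)
    decide (yes y≡0) = subst (_≤ threshold (G ℤ.+ ℤ.1ℤ)) (sym y≡0) (pow10-nonNeg (+ p ℤ.+ (G ℤ.+ ℤ.1ℤ)))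
    decide (no y≢0) = ℚₚ.≤-trans (RoundedPositive.r≤threshold (positive t s y≢0))
                   (pow10-mono-≤ (ℤₚ.+-monoʳ-≤ (+ p) (ℤₚ.+-monoˡ-≤ ℤ.1ℤ (bound s s∈S y≢0))))

  exp-growth : ∀ t G → ExpBound t G → ExpBound (suc t) (G ℤ.+ + growth)
  exp-growth t G bound v v∈S y≢0 = exponent-≤ (rounds (suc t) v) (unrounded>0 (suc t) v y≢0) (G ℤ.+ + growth)
    (subst (unrounded (suc t) v ≤_) sum-bound (mulVec-≤ A v (y t) c c≥0 term≤c))
    where
    c : ℚ
    c = pow10 (+ κ) * threshold (G ℤ.+ ℤ.1ℤ)
    c≥0 : 0ℚ ≤ c
    c≥0 = *-nonNeg (pow10-nonNeg (+ κ)) (pow10-nonNeg (+ p ℤ.+ (G ℤ.+ ℤ.1ℤ)))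
    term≤c : ∀ u → A v u * y t u ≤ c
    term≤c u = [ (λ u∈S → *-mono-≤ (A≥0 v u) (y≥0 t u) (A≤10^κ v u) (y≤threshold t G bound u u∈S))
               , (λ Avu≡0 → subst (_≤ c) (sym (trans (cong (_* y t u) Avu≡0) (ℚₚ.*-zeroˡ (y t u)))) c≥0)
               ]′ (row-of-S v∈S u)
    regroup : ((G ℤ.+ ℤ.1ℤ) ℤ.+ + κ) ℤ.+ + (d ℕ.+ P) ≡ G ℤ.+ + growth
    regroup = trans (solve 4 (λ G o k n → ((G :+ o) :+ k) :+ n := G :+ ((o :+ k) :+ n)) refl G ℤ.1ℤ (+ κ) (+ (d ℕ.+ P)))
      (cong (λ k → G ℤ.+ k) (sym (trans (ℤₚ.pos-+ (1 ℕ.+ κ) (d ℕ.+ P)) (cong (ℤ._+ + (d ℕ.+ P)) (ℤₚ.pos-+ 1 κ)))))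
    sum-bound : pow10 (+ (d ℕ.+ P)) * c ≡ threshold (G ℤ.+ + growth)
    sum-bound = begin
      pow10 (+ (d ℕ.+ P)) * (pow10 (+ κ) * threshold (G ℤ.+ ℤ.1ℤ))
        ≡⟨ cong (pow10 (+ (d ℕ.+ P)) *_) (pow10-*-threshold (+ κ) (G ℤ.+ ℤ.1ℤ)) ⟩
      pow10 (+ (d ℕ.+ P)) * threshold ((G ℤ.+ ℤ.1ℤ) ℤ.+ + κ)
        ≡⟨ pow10-*-threshold (+ (d ℕ.+ P)) ((G ℤ.+ ℤ.1ℤ) ℤ.+ + κ) ⟩
      threshold (((G ℤ.+ ℤ.1ℤ) ℤ.+ + κ) ℤ.+ + (d ℕ.+ P))
        ≡⟨ cong threshold regroup ⟩
      threshold (G ℤ.+ + growth) ∎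

  exp-growth-+ : ∀ k t G → ExpBound t G → ExpBound (t ℕ.+ k) (G ℤ.+ + (k ℕ.* growth))
  exp-growth-+ zero t G bound = subst₂ ExpBound (sym (ℕₚ.+-identityʳ t)) (sym (ℤₚ.+-identityʳ G)) bound
  exp-growth-+ (suc k) t G bound = subst₂ ExpBound (sym (ℕₚ.+-suc t k)) regroup
    (exp-growth (t ℕ.+ k) (G ℤ.+ + (k ℕ.* growth)) (exp-growth-+ k t G bound))
    where
    regroup : (G ℤ.+ + (k ℕ.* growth)) ℤ.+ + growth ≡ G ℤ.+ + (suc k ℕ.* growth)
    regroup = trans (ℤₚ.+-assoc G (+ (k ℕ.* growth)) (+ growth))
      (cong (λ n → G ℤ.+ n) (trans (sym (ℤₚ.pos-+ (k ℕ.* growth) growth)) (cong +_ (ℕₚ.+-comm (k ℕ.* growth) growth))))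

  no-input⇒y≡0 : ∀ t v → (∀ u → S u ≡ true → A v u * y t u ≡ 0ℚ) → S v ≡ true → y (suc t) v ≡ 0ℚ
  no-input⇒y≡0 t v from-S≡0 v∈S = Rounds-zero (rounds (suc t) v) (mulVec-zero A v (y t) term≡0)
    where
    term≡0 : ∀ u → A v u * y t u ≡ 0ℚ
    term≡0 u = [ from-S≡0 u , (λ Avu≡0 → trans (cong (_* y t u) Avu≡0) (ℚₚ.*-zeroˡ (y t u))) ]′ (row-of-S v∈S u)

  Silent : ℕ → Set
  Silent t = ∀ s → S s ≡ true → y t s ≡ 0ℚ

  silent-+ : ∀ k t → Silent t → Silent (t ℕ.+ k)
  silent-+ zero t silent = subst Silent (sym (ℕₚ.+-identityʳ t)) silent
  silent-+ (suc k) t silent = subst Silent (sym (ℕₚ.+-suc t k)) λ v →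
    no-input⇒y≡0 (t ℕ.+ k) v λ u u∈S → trans (cong (A v u *_) (silent-+ k t silent u u∈S)) (ℚₚ.*-zeroʳ (A v u))

  Scaled : ℕ → ℕ → ℤ → Set
  Scaled t t' a = ∀ s → S s ≡ true → y t' s ≡ pow10 a * y t s

  scaled-step : ∀ t t' a → Scaled t t' a → Scaled (suc t) (suc t') a
  scaled-step t t' a scaled s s∈S =
    Rounds-scale a (mulVec-scale A s (pow10 a) (y t) (y t') term-scaled) (rounds (suc t) s) (rounds (suc t') s)
                 (unrounded≥0 (suc t) s)
    where
    term-scaled : ∀ u → A s u * y t' u ≡ pow10 a * (A s u * y t u)
    term-scaled u = [ from-S , from-outside ]′ (row-of-S s∈S u)
      where
      from-S : S u ≡ true → A s u * y t' u ≡ pow10 a * (A s u * y t u)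
      from-S u∈S = trans (cong (A s u *_) (scaled u u∈S))
        (trans (sym (ℚₚ.*-assoc (A s u) (pow10 a) (y t u)))
          (trans (cong (_* y t u) (ℚₚ.*-comm (A s u) (pow10 a))) (ℚₚ.*-assoc (pow10 a) (A s u) (y t u))))
      from-outside : A s u ≡ 0ℚ → A s u * y t' u ≡ pow10 a * (A s u * y t u)
      from-outside Asu≡0 = begin
        A s u * y t' u            ≡⟨ cong (_* y t' u) Asu≡0 ⟩
        0ℚ * y t' u               ≡⟨ ℚₚ.*-zeroˡ (y t' u) ⟩
        0ℚ                        ≡⟨ ℚₚ.*-zeroʳ (pow10 a) ⟨
        pow10 a * 0ℚ              ≡⟨ cong (pow10 a *_) (ℚₚ.*-zeroˡ (y t u)) ⟨
        pow10 a * (0ℚ * y t u)    ≡⟨ cong (λ b → pow10 a * (b * y t u)) Asu≡0 ⟨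
        pow10 a * (A s u * y t u) ∎

  scaled-+ : ∀ k t t' a → Scaled t t' a → Scaled (t ℕ.+ k) (t' ℕ.+ k) a
  scaled-+ zero t t' a scaled = subst₂ (λ t t' → Scaled t t' a) (sym (ℕₚ.+-identityʳ t)) (sym (ℕₚ.+-identityʳ t')) scaled
  scaled-+ (suc k) t t' a scaled = subst₂ (λ t t' → Scaled t t' a) (sym (ℕₚ.+-suc t k)) (sym (ℕₚ.+-suc t' k))
    (scaled-step (t ℕ.+ k) (t' ℕ.+ k) a (scaled-+ k t t' a scaled))

  no-internal-edge⇒periodic : (∀ u v → S u ≡ true → S v ≡ true → ¬ Edge A u v) → PseudoPeriodicOn S y
  no-internal-edge⇒periodic no-edge = 1 , 1 , ℕₚ.≤-refl , (λ _ → ℤ.0ℤ) , periodicity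
    where
    silent : ∀ t → Silent (suc t)
    silent t v v∈S = no-input⇒y≡0 t v (λ u u∈S → trans (cong (_* y t u)
      (decidable-stable (A v u ℚₚ.≟ 0ℚ) (no-edge u v u∈S v∈S))) (ℚₚ.*-zeroˡ (y t u))) v∈S
    periodicity : ∀ t → 1 ℕ.≤ t → ∀ s → S s ≡ true → y (t ℕ.+ 1) s ≡ pow10 ℤ.0ℤ * y t s
    periodicity (suc t) _ s s∈S = trans (subst (λ n → y n s ≡ 0ℚ) (ℕₚ.+-comm 1 (suc t)) (silent (suc t) s s∈S))
      (sym (trans (cong (pow10 ℤ.0ℤ *_) (silent t s s∈S)) (ℚₚ.*-zeroʳ (pow10 ℤ.0ℤ))))

  module Periodicity (L : ℕ) (P∣L : P ∣ L)
    (uniform : ∀ u v → S u ≡ true → S v ≡ true → proj₂ u ≡ proj₂ v → Walk A L u v) where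

    Live : ℕ → V → Set
    Live t v = S v ≡ true × y t v ≢ 0ℚ

    live? : ∀ t v → Dec (Live t v)
    live? t v = (S v Boolₚ.≟ true) ×-dec ¬? (y t v ℚₚ.≟ 0ℚ)

    Leader : ℕ → Set
    Leader t = (∀ v → ¬ Live t v) ⊎ Argmax (Live t) (exp t)

    leader : ∀ t → Leader t
    leader t = argmax-× (Live t) (live? t) (exp t)

    -- Junk value 0 when no coordinate of S is live at time t.
    topExpOf : ∀ t → Leader t → ℤ
    topExpOf t (inj₁ _) = ℤ.0ℤ
    topExpOf t (inj₂ (v , _)) = exp t v

    topExp : ℕ → ℤ
    topExp t = topExpOf t (leader t)

    exp≤topExpOf : ∀ t (l : Leader t) {s} → Live t s → exp t s ℤ.≤ topExpOf t l
    exp≤topExpOf t (inj₁ none) live = ⊥-elim (none _ live)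
    exp≤topExpOf t (inj₂ (v , _ , max)) live = max _ live

    topExpOf-attained : ∀ t (l : Leader t) {s} → Live t s → Σ V λ v → Live t v × topExpOf t l ≡ exp t v
    topExpOf-attained t (inj₁ none) live = ⊥-elim (none _ live)
    topExpOf-attained t (inj₂ (v , v-live , _)) _ = v , v-live , refl

    no-leader⇒silent : ∀ t → (∀ v → ¬ Live t v) → Silent t
    no-leader⇒silent t none s s∈S = decidable-stable (y t s ℚₚ.≟ 0ℚ) (λ y≢0 → none s (s∈S , y≢0))

    ρ : ℕ
    ρ = L ℕ.* (κ ℕ.+ growth)

    -- Compare both with the leader u at time τ: the walk u → s loses at most L·κ, growth from u adds at most L·growth.
    spread : ∀ τ {s v} → Live (τ ℕ.+ L) s → Live (τ ℕ.+ L) v → exp (τ ℕ.+ L) v ℤ.≤ exp (τ ℕ.+ L) s ℤ.+ + ρ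
    spread τ {s} {v} (s∈S , ys≢0) (v∈S , yv≢0) = via (leader τ)
      where
      t : ℕ
      t = τ ℕ.+ L
      via : Leader τ → exp t v ℤ.≤ exp t s ℤ.+ + ρ
      via (inj₁ none) = ⊥-elim (ys≢0 (silent-+ L τ (no-leader⇒silent τ none) s s∈S))
      via (inj₂ (u , (u∈S , yu≢0) , max)) =
        ℤₚ.≤-trans v≤u+Lg (ℤₚ.≤-trans (ℤₚ.+-monoˡ-≤ (+ (L ℕ.* growth)) u≤s+Lκ) (ℤₚ.≤-reflexive regroup))
        where
        same-phase : proj₂ u ≡ proj₂ s
        same-phase = Finₚ.toℕ-injective (trans (phase τ yu≢0)
          (sym (trans (phase t ys≢0) (ℕ.%-remove-+ʳ τ P∣L))))
        u≤s+Lκ : exp τ u ℤ.≤ exp t s ℤ.+ + (L ℕ.* κ)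
        u≤s+Lκ = proj₂ (walk-step τ (uniform u s u∈S s∈S same-phase) yu≢0)
        v≤u+Lg : exp t v ℤ.≤ exp τ u ℤ.+ + (L ℕ.* growth)
        v≤u+Lg = exp-growth-+ L τ (exp τ u) (λ w w∈S yw≢0 → max w (w∈S , yw≢0)) v v∈S yv≢0
        regroup : (exp t s ℤ.+ + (L ℕ.* κ)) ℤ.+ + (L ℕ.* growth) ≡ exp t s ℤ.+ + ρ
        regroup = trans (ℤₚ.+-assoc (exp t s) (+ (L ℕ.* κ)) (+ (L ℕ.* growth)))
          (cong (λ n → exp t s ℤ.+ n)
                (trans (sym (ℤₚ.pos-+ (L ℕ.* κ) (L ℕ.* growth))) (cong +_ (sym (ℕₚ.*-distribˡ-+ L κ growth)))))

    gap : ℕ → V → ℕ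
    gap t s = ℤ.∣ topExp t ℤ.- exp t s ∣

    gap≡ : ∀ t {s} → Live t s → + gap t s ≡ topExp t ℤ.- exp t s
    gap≡ t live = ℤₚ.0≤i⇒+∣i∣≡i (ℤₚ.i≤j⇒0≤j-i (exp≤topExpOf t (leader t) live))

    gap≤ρ : ∀ τ {s} → Live (τ ℕ.+ L) s → gap (τ ℕ.+ L) s ℕ.≤ ρ
    gap≤ρ τ {s} live = bound (topExpOf-attained t (leader t) live)
      where
      t : ℕ
      t = τ ℕ.+ L
      bound : Σ V (λ v → Live t v × topExp t ≡ exp t v) → gap t s ℕ.≤ ρ
      bound (v , v-live , top≡v) = ℤₚ.drop‿+≤+ (subst₂ ℤ._≤_
        (sym (trans (gap≡ t live) (cong (ℤ._- exp t s) top≡v)))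
        (solve 2 (λ e r → (e :+ r) :+ (:- e) := r) refl (exp t s) (+ ρ))
        (ℤₚ.+-monoˡ-≤ (ℤ.- exp t s) (spread τ live v-live)))

    -- A live coordinate is recorded by its mantissa and its gap to the top exponent, both bounded after time L.
    codeOf : ∀ t s → Dec (Live t s) → ℕ
    codeOf t s (yes _) = suc (gap t s ℕ.+ suc ρ ℕ.* mant t s)
    codeOf t s (no _) = 0

    code : ℕ → V → ℕ
    code t s = codeOf t s (live? t s)

    codeBound : ℕ
    codeBound = suc (suc ρ ℕ.* suc (10 ℕ.^ p))

    code< : ∀ τ s → code (τ ℕ.+ L) s ℕ.< codeBound
    code< τ s = bound (live? t s)
      where
      t : ℕ
      t = τ ℕ.+ L
      bound : (l : Dec (Live t s)) → codeOf t s l ℕ.< codeBound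
      bound (no _) = ℕ.s≤s ℕ.z≤n
      bound (yes live@(_ , y≢0)) = ℕ.s≤s (ℕₚ.<-≤-trans
        (ℕₚ.+-monoˡ-< (suc ρ ℕ.* mant t s) (ℕ.s≤s (gap≤ρ τ live)))
        (subst (ℕ._≤ suc ρ ℕ.* suc (10 ℕ.^ p)) (ℕₚ.*-suc (suc ρ) (mant t s))
               (ℕₚ.*-monoʳ-≤ (suc ρ) (ℕ.s≤s (RoundedPositive.K≤10^p (positive t s y≢0))))))

    same-code⇒scaled : ∀ τ τ' → (∀ s → S s ≡ true → code (τ ℕ.+ L) s ≡ code (τ' ℕ.+ L) s) →
                       Scaled (τ ℕ.+ L) (τ' ℕ.+ L) (topExp (τ' ℕ.+ L) ℤ.- topExp (τ ℕ.+ L))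
    same-code⇒scaled τ τ' same s s∈S = compare (live? t s) (live? t' s) (same s s∈S)
      where
      t : ℕ
      t = τ ℕ.+ L
      t' : ℕ
      t' = τ' ℕ.+ L
      a : ℤ
      a = topExp t' ℤ.- topExp t
      silent : ∀ t → ¬ Live t s → y t s ≡ 0ℚ
      silent t dead = decidable-stable (y t s ℚₚ.≟ 0ℚ) (λ y≢0 → dead (s∈S , y≢0))
      compare : (l : Dec (Live t s)) (l' : Dec (Live t' s)) → codeOf t s l ≡ codeOf t' s l' → y t' s ≡ pow10 a * y t s
      compare (no dead) (no dead') _ =
        trans (silent t' dead') (sym (trans (cong (pow10 a *_) (silent t dead)) (ℚₚ.*-zeroʳ (pow10 a))))
      compare (yes live) (yes live') same-code = begin
        y t' s
          ≡⟨ RoundedPositive.r≡K*10^[e+1] (positive t' s (proj₂ live')) ⟩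
        ℕ→ℚ (mant t' s) * pow10 (exp t' s ℤ.+ ℤ.1ℤ)
          ≡⟨ cong₂ (λ K e → ℕ→ℚ K * pow10 e) (sym (proj₂ same-digits)) exp-shift ⟩
        ℕ→ℚ (mant t s) * pow10 (a ℤ.+ (exp t s ℤ.+ ℤ.1ℤ))
          ≡⟨ *-pow10-+ (ℕ→ℚ (mant t s)) a (exp t s ℤ.+ ℤ.1ℤ) ⟩
        pow10 a * (ℕ→ℚ (mant t s) * pow10 (exp t s ℤ.+ ℤ.1ℤ))
          ≡⟨ cong (pow10 a *_) (RoundedPositive.r≡K*10^[e+1] (positive t s (proj₂ live))) ⟨
        pow10 a * y t s ∎
        where
        same-digits : gap t s ≡ gap t' s × mant t s ≡ mant t' s
        same-digits = digit-unique (ℕ.s≤s (gap≤ρ τ live)) (ℕ.s≤s (gap≤ρ τ' live')) (ℕₚ.suc-injective same-code)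
        same-gap : topExp t ℤ.- exp t s ≡ topExp t' ℤ.- exp t' s
        same-gap = trans (sym (gap≡ t live)) (trans (cong +_ (proj₁ same-digits)) (gap≡ t' live'))
        exp-shift : exp t' s ℤ.+ ℤ.1ℤ ≡ a ℤ.+ (exp t s ℤ.+ ℤ.1ℤ)
        exp-shift = trans (cong (ℤ._+ ℤ.1ℤ) (j'≡[i'-i]+j (topExp t) (exp t s) (topExp t') (exp t' s) same-gap))
                          (ℤₚ.+-assoc a (exp t s) ℤ.1ℤ)
      compare (no _) (yes _) ()
      compare (yes _) (no _) ()

    codeVector : ℕ → ℕ
    codeVector t = fromDigits-× codeBound (code t)

    periodic : PseudoPeriodicOn S y
    periodic = from-collision (Finₚ.pigeonhole (ℕₚ.n<1+n (codeBound ℕ.^ (d ℕ.* P))) codeAt)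
      where
      codeAt : Fin (suc (codeBound ℕ.^ (d ℕ.* P))) → Fin (codeBound ℕ.^ (d ℕ.* P))
      codeAt τ = Fin.fromℕ< (fromDigits-×-< codeBound (code (toℕ τ ℕ.+ L)) (code< (toℕ τ)))
      from-collision : (Σ _ λ τ → Σ _ λ τ' → τ Fin.< τ' × codeAt τ ≡ codeAt τ') → PseudoPeriodicOn S y
      from-collision (τ , τ' , τ<τ' , collision) = N , period , ℕₚ.m<n⇒0<n∸m τ<τ' , (λ _ → a) , periodicity
        where
        N : ℕ
        N = toℕ τ ℕ.+ L
        period : ℕ
        period = toℕ τ' ℕ.∸ toℕ τ
        a : ℤ
        a = topExp (toℕ τ' ℕ.+ L) ℤ.- topExp N
        same-vector : codeVector N ≡ codeVector (toℕ τ' ℕ.+ L)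
        same-vector = trans (sym (Finₚ.toℕ-fromℕ< _)) (trans (cong toℕ collision) (Finₚ.toℕ-fromℕ< _))
        scaled : Scaled N (toℕ τ' ℕ.+ L) a
        scaled = same-code⇒scaled (toℕ τ) (toℕ τ')
          (λ s _ → fromDigits-×-injective codeBound _ _ (code< (toℕ τ)) (code< (toℕ τ')) same-vector s)
        periodicity : ∀ t → N ℕ.≤ t → ∀ s → S s ≡ true → y (t ℕ.+ period) s ≡ pow10 a * y t s
        periodicity t N≤t = subst₂ (λ t₁ t₂ → Scaled t₁ t₂ a) (ℕₚ.m+[n∸m]≡n N≤t) shifted
          (scaled-+ (t ℕ.∸ N) N (toℕ τ' ℕ.+ L) a scaled)
          where
          shifted : toℕ τ' ℕ.+ L ℕ.+ (t ℕ.∸ N) ≡ t ℕ.+ period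
          shifted = begin
            toℕ τ' ℕ.+ L ℕ.+ (t ℕ.∸ N)
              ≡⟨ cong (λ n → n ℕ.+ L ℕ.+ (t ℕ.∸ N)) (ℕₚ.m+[n∸m]≡n (ℕₚ.<⇒≤ τ<τ')) ⟨
            toℕ τ ℕ.+ period ℕ.+ L ℕ.+ (t ℕ.∸ N)      ≡⟨ m+n+o+p≡m+o+p+n (toℕ τ) period L (t ℕ.∸ N) ⟩
            N ℕ.+ (t ℕ.∸ N) ℕ.+ period                ≡⟨ cong (ℕ._+ period) (ℕₚ.m+[n∸m]≡n N≤t) ⟩
            t ℕ.+ period                              ∎

-- Walks of one common length inside S

module UniformWalks {d : ℕ} (M : Matrix (Fin d)) (P : ℕ) .{{_ : ℕ.NonZero P}} (lcm : IsCycleLCM M P)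
  (S : Q' d P → Bool) (scc : IsSCC (M′ P M) S)
  {u₀ v₀ : Q' d P} (u₀∈S : S u₀ ≡ true) (v₀∈S : S v₀ ≡ true) (e₀ : Edge (M′ P M) u₀ v₀) where

  V : Set
  V = Q' d P

  A : Matrix V
  A = M′ P M

  -- Junk length 0 when an endpoint lies outside S.
  walk-in-S : ∀ u v → Σ ℕ λ n → S u ≡ true → S v ≡ true → Walk A n u v
  walk-in-S u v = choose (S u Boolₚ.≟ true) (S v Boolₚ.≟ true)
    where
    choose : Dec (S u ≡ true) → Dec (S v ≡ true) → Σ ℕ λ n → S u ≡ true → S v ≡ true → Walk A n u v
    choose (yes u∈S) (yes v∈S) = proj₁ (Star⇒Walk (reach u∈S v∈S)) , λ _ _ → proj₂ (Star⇒Walk (reach u∈S v∈S))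
      where reach = proj₁ (proj₂ scc) u v
    choose (no u∉S) _ = 0 , λ u∈S _ → ⊥-elim (u∉S u∈S)
    choose (yes _) (no v∉S) = 0 , λ _ v∈S → ⊥-elim (v∉S v∈S)

  ℓ : ℕ
  ℓ = suc (proj₁ (walk-in-S v₀ u₀))

  loop : Walk A ℓ u₀ u₀
  loop = e₀ ∷ proj₂ (walk-in-S v₀ u₀) v₀∈S u₀∈S

  ν : ℕ → Fin d
  ν n = proj₁ (vertexAt loop n)

  ν-edge : ∀ n → n ℕ.< ℓ → Edge M (ν n) (ν (suc n))
  ν-edge n n<ℓ = proj₂ (M′-edge⇒ P M (vertexAt loop n) (vertexAt loop (suc n)) (vertexAt-edge loop n n<ℓ))

  simple : Σ ℕ λ i → Σ ℕ λ k → i ℕ.+ k ℕ.≤ ℓ × SimpleCycle M k × ν (i ℕ.+ k) ≡ ν i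
  simple = closedWalk⇒simpleCycle M ν ℓ (ℕ.s≤s ℕ.z≤n) ν-edge
             (cong proj₁ (trans (vertexAt-0 loop) (sym (vertexAt-end loop))))

  i k : ℕ
  i = proj₁ simple
  k = proj₁ (proj₂ simple)

  i+k≤ℓ : i ℕ.+ k ℕ.≤ ℓ
  i+k≤ℓ = proj₁ (proj₂ (proj₂ simple))

  k∣P : k ∣ P
  k∣P = proj₁ lcm k (proj₁ (proj₂ (proj₂ (proj₂ simple))))

  hub : V
  hub = vertexAt loop i

  hub∈S : S hub ≡ true
  hub∈S = proj₂ (proj₂ scc) u₀ hub u₀∈S (reach-vertexAt loop i) (vertexAt-reach loop i)

  simple-loop : Walk M k (ν i) (ν i)
  simple-loop = subst (Walk M k (ν i)) (proj₂ (proj₂ (proj₂ (proj₂ simple))))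
    (segment M ν k i (λ n n<k → ν-edge (i ℕ.+ n) (ℕₚ.<-≤-trans (ℕₚ.+-monoʳ-< i n<k) i+k≤ℓ)))

  hub-loop : Walk A P hub hub
  hub-loop = lift P M (subst (λ n → Walk M n (ν i) (ν i)) (sym (_∣_.equality k∣P)) (replicateʷ (quotient k∣P) simple-loop))
    (proj₂ hub) (proj₂ hub) (sym (trans (ℕ.[m+n]%n≡m%n (toℕ (proj₂ hub)) P) (toℕ%P P (proj₂ hub))))

  maxV : (V → ℕ) → ℕ
  maxV f = maxFin (λ q → maxFin (λ j → f (q , j)))

  ≤-maxV : ∀ f v → f v ℕ.≤ maxV f
  ≤-maxV f (q , j) = ℕₚ.≤-trans (≤-maxFin (λ j → f (q , j)) j) (≤-maxFin (λ q → maxFin (λ j → f (q , j))) q)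

  m : ℕ
  m = maxV (λ u → proj₁ (walk-in-S u hub)) ℕ.+ maxV (λ v → proj₁ (walk-in-S hub v))

  L : ℕ
  L = m ℕ.* P

  P∣L : P ∣ L
  P∣L = divides m refl

  -- Go to the hub, wind around hub-loop to pad the length to L, and leave the hub.
  uniform : ∀ u v → S u ≡ true → S v ≡ true → proj₂ u ≡ proj₂ v → Walk A L u v
  uniform u v u∈S v∈S same-phase = subst (λ n → Walk A n u v) length≡L (to ++ʷ (replicateʷ (m ℕ.∸ c) hub-loop ++ʷ from))
    where
    ℓ₁ ℓ₂ : ℕ
    ℓ₁ = proj₁ (walk-in-S u hub)
    ℓ₂ = proj₁ (walk-in-S hub v)
    to : Walk A ℓ₁ u hub
    to = proj₂ (walk-in-S u hub) u∈S hub∈S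
    from : Walk A ℓ₂ hub v
    from = proj₂ (walk-in-S hub v) hub∈S v∈S
    P∣ℓ₁+ℓ₂ : P ∣ ℓ₁ ℕ.+ ℓ₂
    P∣ℓ₁+ℓ₂ = %-fixed⇒∣ (toℕ (proj₂ u)) (ℓ₁ ℕ.+ ℓ₂) P
      (sym (trans (cong toℕ same-phase) (Walk-phase P M (to ++ʷ from))))
    c : ℕ
    c = quotient P∣ℓ₁+ℓ₂
    c≤m : c ℕ.≤ m
    c≤m = ℕₚ.≤-trans (ℕₚ.m≤m*n c P) (ℕₚ.≤-trans (ℕₚ.≤-reflexive (sym (_∣_.equality P∣ℓ₁+ℓ₂)))
            (ℕₚ.+-mono-≤ (≤-maxV (λ u → proj₁ (walk-in-S u hub)) u) (≤-maxV (λ v → proj₁ (walk-in-S hub v)) v)))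
    length≡L : ℓ₁ ℕ.+ ((m ℕ.∸ c) ℕ.* P ℕ.+ ℓ₂) ≡ L
    length≡L = begin
      ℓ₁ ℕ.+ ((m ℕ.∸ c) ℕ.* P ℕ.+ ℓ₂)   ≡⟨ cong (ℓ₁ ℕ.+_) (ℕₚ.+-comm ((m ℕ.∸ c) ℕ.* P) ℓ₂) ⟩
      ℓ₁ ℕ.+ (ℓ₂ ℕ.+ (m ℕ.∸ c) ℕ.* P)   ≡⟨ ℕₚ.+-assoc ℓ₁ ℓ₂ _ ⟨
      ℓ₁ ℕ.+ ℓ₂ ℕ.+ (m ℕ.∸ c) ℕ.* P     ≡⟨ cong (ℕ._+ (m ℕ.∸ c) ℕ.* P) (_∣_.equality P∣ℓ₁+ℓ₂) ⟩
      c ℕ.* P ℕ.+ (m ℕ.∸ c) ℕ.* P       ≡⟨ ℕₚ.*-distribʳ-+ P c (m ℕ.∸ c) ⟨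
      (c ℕ.+ (m ℕ.∸ c)) ℕ.* P           ≡⟨ cong (ℕ._* P) (ℕₚ.m+[n∸m]≡n c≤m) ⟩
      m ℕ.* P                           ∎

lemma4 : (p : ℕ) → .{{_ : NonZero p}} → (tie : TieRule)
       → (d : ℕ) (M : Matrix (Fin d)) (x : Fin d → ℚ)
       → (∀ q q' → 0ℚ ≤ M q q') → (∀ q → 0ℚ ≤ x q)
       → (P : ℕ) → IsCycleLCM M P
       → (y : ℕ → Q' d P → ℚ) → IsRoundedOrbit p tie (M′ P M) (x′ P x) y
       → (S : Q' d P → Bool) → IsSCC (M′ P M) S → IsTop (M′ P M) S
       → PseudoPeriodicOn S y
lemma4 (suc p₀) tie d M x M≥0 x≥0 zero lcm y orbit S (((_ , ()) , _) , _) top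
lemma4 (suc p₀) tie d M x M≥0 x≥0 P@(suc _) lcm y orbit S scc top = by-cases internal-edge?
  where
  bounds : Σ ℕ (Pow10Bounded M)
  bounds = entries-between-pow10 M M≥0
  open Orbit p₀ tie M x M≥0 x≥0 P y orbit S top (proj₁ bounds) (proj₂ bounds)
  InternalEdge : Set
  InternalEdge = Σ V λ u → Σ V λ v → S u ≡ true × S v ≡ true × Edge A u v
  internal-edge? : Dec InternalEdge
  internal-edge? = any?-× _ λ u → any?-× _ λ v →
    (S u Boolₚ.≟ true) ×-dec (S v Boolₚ.≟ true) ×-dec ¬? (A v u ℚₚ.≟ 0ℚ)
  by-cases : Dec InternalEdge → PseudoPeriodicOn S y
  by-cases (yes (u , v , u∈S , v∈S , e)) = Periodicity.periodic L P∣L uniform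
    where open UniformWalks M P lcm S scc u∈S v∈S e
  by-cases (no none) = no-internal-edge⇒periodic λ u v u∈S v∈S e → none (u , v , u∈S , v∈S , e)
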